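{- Let $\mathcal{H}$ be the class of graphs consisting of all complete multipartite graphs, all even cycles, and all paths. Let $F$ be a bipartite graph and let $H$ be an $\mathcal{H}$-blow-up of $F$. Then for every integer $q\ge 2$, \[ \hom(H,K_q)^2\le \hom(H\times K_2,K_q). \]
   Context: $\hom(H,G)$ denotes the number of graph homomorphisms from $H$ to $G$ (vertex maps sending edges to edges); $K_q$ is the loopless complete graph on $q$ vertices, so $\hom(H,K_q)$ is the number of proper $q$-colourings of $H$. The tensor product $H\times K_2$ has vertex set $V(H)\times\{1,2\}$, with $(u,i)$ adjacent to $(v,j)$ iff $uv\in E(H)$ and $i\neq j$. For a class $\mathcal{H}$ of graphs and a graph $F$ on vertices $v_1,\dots,v_k$, an $\mathcal{H}$-blow-up of $F$ is obtained by choosing $H_1,\dots,H_k\in\mathcal{H}$, taking the disjoint union of $H_1,\dots,H_k$ (replacing $v_i$ by $H_i$), and adding all edges between $V(H_i)$ and $V(H_j)$ (a complete bipartite graph $K_{|V(H_i)|,|V(H_j)|}$) whenever $v_iv_j\in E(F)$. Complete $1$-partite graphs are edgeless graphs, so in particular $K_1$ belongs to $\mathcal{H}$. -}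

module Defs where

open import Data.Bool.Base using (Bool)
open import Data.Empty using (⊥; ⊥-elim)
open import Data.Fin.Base using (Fin; zero; suc; toℕ; finToFun)
open import Data.Fin.Properties as Fin using (+↔⊎; *↔×; all?; inj⇒≟)
open import Data.List.Base using (length; filter; allFin)
open import Data.Nat.Base using (ℕ; zero; suc; _+_; _*_; _^_; _≤_; s≤s; NonZero)
open import Data.Nat.Divisibility using (_∣_)
import Data.Nat.Properties as ℕ
open import Data.Product.Base using (Σ; Σ-syntax; ∃-syntax; _×_; _,_; proj₁; proj₂)
open import Data.Product.Function.Dependent.Propositional using (Σ-↔)
open import Data.Product.Function.NonDependent.Propositional using (_×-↔_)
open import Data.Sum.Base using (_⊎_; inj₁; inj₂; [_,_]; swap)
open import Data.Sum.Function.Propositional using (_⊎-↔_)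
open import Data.Vec.Functional using (foldr)
open import Function.Base using (_∘_)
open import Function.Bundles using (_↔_; _⇔_; Inverse; mk↔ₛ′)
open import Function.Construct.Composition using (_↔-∘_)
open import Function.Construct.Identity using (↔-id)
open import Function.Construct.Symmetry using (↔-sym)
open import Function.Definitions using (Surjective)
open import Function.Properties.Inverse using (↔⇒↣)
open import Relation.Binary.Definitions using (Decidable; DecidableEquality; Symmetric; Irreflexive)
open import Relation.Binary.PropositionalEquality using (_≡_; _≢_; refl; sym; trans; cong; subst₂)
open import Relation.Nullary.Decidable using (Dec; yes; no; map′; _×-dec_; _⊎-dec_; _→-dec_; ¬?)

record Graph : Set₁ where
  infix 4 _~_
  field
    V        : Set
    size     : ℕ
    index    : V ↔ Fin size
    _~_      : V → V → Set
    ~-sym    : Symmetric _~_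
    ~-irrefl : Irreflexive _≡_ _~_
    _~?_     : Decidable _~_

  vertex : Fin size → V
  vertex = Inverse.from index

  _≟ⱽ_ : DecidableEquality V
  _≟ⱽ_ = inj⇒≟ (↔⇒↣ index)

open Graph using (V; size)

record _≅_ (G H : Graph) : Set where
  private
    module G = Graph G
    module H = Graph H
  field
    bijection : V G ↔ V H
  open Inverse bijection public using (to)
  field
    preserves : ∀ u v → (u G.~ v) ⇔ (to u H.~ to v)

module _ (H G : Graph) where
  private
    module H = Graph H
    module G = Graph G

  IsHom : (V H → V G) → Set
  IsHom f = ∀ u v → u H.~ v → f u G.~ f v

  isHom? : ∀ f → Dec (IsHom f)
  isHom? f = map′ fromIndices (λ h i j → h (H.vertex i) (H.vertex j))
    (all? λ i → all? λ j →
      (H.vertex i H.~? H.vertex j) →-dec (f (H.vertex i) G.~? f (H.vertex j)))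
    where
    open Inverse H.index using (to; strictlyInverseʳ)
    P : V H → V H → Set
    P u v = u H.~ v → f u G.~ f v
    fromIndices : (∀ i j → P (H.vertex i) (H.vertex j)) → IsHom f
    fromIndices h u v = subst₂ P (strictlyInverseʳ u) (strictlyInverseʳ v) (h (to u) (to v))

  -- `finToFun` is a bijection from Fin (m ^ n) to the maps Fin n → Fin m
  -- (taken up to pointwise equality), so this lists each vertex map exactly once.
  vertexMap : Fin (size G ^ size H) → V H → V G
  vertexMap k = G.vertex ∘ finToFun k ∘ Inverse.to H.index

  hom : ℕ
  hom = length (filter (isHom? ∘ vertexMap) (allFin (size G ^ size H)))

K : ℕ → Graph
K q = record
  { V        = Fin q
  ; size     = q
  ; index    = ↔-id (Fin q)
  ; _~_      = _≢_
  ; ~-sym    = λ i≢j → i≢j ∘ sym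
  ; ~-irrefl = λ i≡j i≢j → i≢j i≡j
  ; _~?_     = λ i j → ¬? (i Fin.≟ j)
  }

infixl 7 _×ᵍ_

_×ᵍ_ : Graph → Graph → Graph
G ×ᵍ H = record
  { V        = V G × V H
  ; size     = size G * size H
  ; index    = ↔-sym *↔× ↔-∘ (G.index ×-↔ H.index)
  ; _~_      = λ (u , i) (v , j) → u G.~ v × i H.~ j
  ; ~-sym    = λ (e , e′) → G.~-sym e , H.~-sym e′
  ; ~-irrefl = λ p (e , _) → G.~-irrefl (cong proj₁ p) e
  ; _~?_     = λ (u , i) (v , j) → (u G.~? v) ×-dec (i H.~? j)
  }
  where
  module G = Graph G
  module H = Graph H

Bipartite : Graph → Set
Bipartite G = Σ[ side ∈ (V G → Bool) ] (∀ u v → u ~ v → side u ≢ side v)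
  where open Graph G using (_~_)

-- The parts are the fibres of `part`; surjectivity makes them nonempty.
CompleteMultipartite : Graph → Set
CompleteMultipartite G =
  ∃[ r ] NonZero r × Σ[ part ∈ (V G → Fin r) ]
    (Surjective _≡_ _≡_ part × (∀ u v → (u ~ v) ⇔ (part u ≢ part v)))
  where open Graph G using (_~_)

module _ {n : ℕ} where

  Next : Fin n → Fin n → Set
  Next i j = suc (toℕ i) ≡ toℕ j

  Wrap : Fin n → Fin n → Set
  Wrap i j = suc (toℕ i) ≡ n × toℕ j ≡ 0

  CyclicNext : Fin n → Fin n → Set
  CyclicNext i j = Next i j ⊎ Wrap i j

  next? : Decidable Next
  next? i j = suc (toℕ i) ℕ.≟ toℕ j

  cyclicNext? : Decidable CyclicNext
  cyclicNext? i j = next? i j ⊎-dec ((suc (toℕ i) ℕ.≟ n) ×-dec (toℕ j ℕ.≟ 0))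

  next-irrefl : ∀ {i} → Next i i → ⊥
  next-irrefl = ℕ.1+n≢n

  cyclicNext-irrefl : 3 ≤ n → ∀ {i} → CyclicNext i i → ⊥
  cyclicNext-irrefl 3≤n (inj₁ e)       = next-irrefl e
  cyclicNext-irrefl 3≤n (inj₂ (l , f)) with trans (sym l) (cong suc f)
  cyclicNext-irrefl (s≤s ()) (inj₂ _) | refl

path : ℕ → Graph
path n = record
  { V        = Fin n
  ; size     = n
  ; index    = ↔-id (Fin n)
  ; _~_      = λ i j → Next i j ⊎ Next j i
  ; ~-sym    = swap
  ; ~-irrefl = λ { refl → [ next-irrefl , next-irrefl ] }
  ; _~?_     = λ i j → next? i j ⊎-dec next? j i
  }

cycle : (n : ℕ) → 3 ≤ n → Graph
cycle n 3≤n = record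
  { V        = Fin n
  ; size     = n
  ; index    = ↔-id (Fin n)
  ; _~_      = λ i j → CyclicNext i j ⊎ CyclicNext j i
  ; ~-sym    = swap
  ; ~-irrefl = λ { refl → [ cyclicNext-irrefl 3≤n , cyclicNext-irrefl 3≤n ] }
  ; _~?_     = λ i j → cyclicNext? i j ⊎-dec cyclicNext? j i
  }

EvenCycle : Graph → Set
EvenCycle G = ∃[ n ] Σ[ 3≤n ∈ 3 ≤ n ] (2 ∣ n × G ≅ cycle n 3≤n)

Path : Graph → Set
Path G = ∃[ n ] NonZero n × G ≅ path n

𝓗 : Graph → Set
𝓗 G = CompleteMultipartite G ⊎ EvenCycle G ⊎ Path G

∑ : ∀ {n} → (Fin n → ℕ) → ℕ
∑ = foldr _+_ 0

Σ-Fin-suc : ∀ {n} {A : Fin (suc n) → Set} → Σ (Fin (suc n)) A ↔ (A zero ⊎ Σ (Fin n) (A ∘ suc))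
Σ-Fin-suc = mk↔ₛ′
  (λ { (zero , x) → inj₁ x ; (suc i , x) → inj₂ (i , x) })
  (λ { (inj₁ x) → zero , x ; (inj₂ (i , x)) → suc i , x })
  (λ { (inj₁ _) → refl ; (inj₂ _) → refl })
  (λ { (zero , _) → refl ; (suc _ , _) → refl })

Σ-Fin↔Fin-∑ : ∀ {n} (m : Fin n → ℕ) → Σ (Fin n) (Fin ∘ m) ↔ Fin (∑ m)
Σ-Fin↔Fin-∑ {zero}  m = mk↔ₛ′ (λ { (() , _) }) (λ ()) (λ ()) (λ { (() , _) })
Σ-Fin↔Fin-∑ {suc n} m =
  ↔-sym +↔⊎ ↔-∘ ((↔-id _ ⊎-↔ Σ-Fin↔Fin-∑ (m ∘ suc)) ↔-∘ Σ-Fin-suc)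

module _ (F : Graph) (Hs : V F → Graph) where
  private
    module F = Graph F
    module Hs v = Graph (Hs v)

  data BlowUpAdj : Σ (V F) (V ∘ Hs) → Σ (V F) (V ∘ Hs) → Set where
    within : ∀ {i x y} → Hs._~_ i x y → BlowUpAdj (i , x) (i , y)
    across : ∀ {i j x y} → i F.~ j → BlowUpAdj (i , x) (j , y)

  blowUp-sym : Symmetric BlowUpAdj
  blowUp-sym (within e) = within (Hs.~-sym _ e)
  blowUp-sym (across e) = across (F.~-sym e)

  blowUp-irrefl : Irreflexive _≡_ BlowUpAdj
  blowUp-irrefl refl (within e) = Hs.~-irrefl _ refl e
  blowUp-irrefl refl (across e) = F.~-irrefl refl e

  blowUp? : Decidable BlowUpAdj
  blowUp? (i , x) (j , y) with i F.~? j
  ... | yes e = yes (across e)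
  ... | no ¬e with i F.≟ⱽ j
  ...   | no i≢j = no λ { (within _) → i≢j refl ; (across e) → ¬e e }
  ...   | yes refl = map′ within (λ { (within e) → e ; (across e) → ⊥-elim (¬e e) }) (Hs._~?_ i x y)

  blowUp : Graph
  blowUp = record
    { V        = Σ (V F) (V ∘ Hs)
    ; size     = ∑ (size ∘ Hs ∘ F.vertex)
    ; index    = Σ-Fin↔Fin-∑ _ ↔-∘ ↔-sym (Σ-↔ (↔-sym F.index) (↔-sym (Hs.index _)))
    ; _~_      = BlowUpAdj
    ; ~-sym    = blowUp-sym
    ; ~-irrefl = blowUp-irrefl
    ; _~?_     = blowUp?
    }

IsBlowUp : (Graph → Set) → Graph → Graph → Set₁
IsBlowUp 𝓒 F H = Σ[ Hs ∈ (V F → Graph) ] ((∀ v → 𝓒 (Hs v)) × H ≅ blowUp F Hs)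

{-# OPTIONS --safe #-}
module Submission where

-- A colouring of H × K₂ is a pair (f , g) of maps on the vertices of H with f u ≠ g v for all edges uv.
-- Exchanging f and g on one side of F makes all edges between different parts behave as in a pair of
-- independent proper colourings of H, so only the edges inside the parts differ. The parts are then
-- treated one by one: with all others fixed, f and g have to take their values on a part in the palettes
-- X and Y left free by the neighbouring parts, and it suffices that for all palettes X and Y
--   #{f : G → X proper} · #{g : G → Y proper} ≤ #{(f , g) : f : G → X, g : G → Y, f u ≠ g v for u ~ v}.
-- * Paths: a pendant vertex multiplies the left side by (|X| - 1)(|Y| - 1) and the right side by at least
--   that much.
-- * Complete multipartite graphs: remove one part P of m vertices. By induction the right side is at least
--   the number of colourings with P in Y and the rest in X times the number with the palettes exchanged.
--   The first factor is at least (|Y| / |X|)^m times the number of X-colourings, since a map P → Y uses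
--   stochastically fewer colours of X than a map P → X does, and symmetrically for the second factor.
-- * Even cycles: swapping on every second vertex turns the right side into the square of the trace of a
--   power of a transfer matrix. If |X| ≤ |Y|, the two-step matrix on X dominates (|Y| - 2) J + I
--   entrywise, with equality if X = Y, and the claim becomes an inequality between explicit powers.

open import Data.Nat.Base using (ℕ; _≤_; _^_)
open import Defs

import Algebra.Properties.Semiring.Sum
open import Data.Bool.Base using (Bool; true; false; T; if_then_else_; _∧_; not)
open import Data.Bool.Properties using (T-∧; ∧-assoc; ∧-comm; ∧-idem; ∧-identityʳ; not-involutive)
open import Data.Fin.Base using (Fin; zero; suc; toℕ; _↑ˡ_; _↑ʳ_; finToFun; funToFin; remQuot; combine)
open import Data.Fin.Properties as Fin
  using (finToFun-funToFin; funToFin-finToFin; remQuot-combine; combine-remQuot; all?; _≟_)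
open import Data.List.Base using (length; filter; tabulate)
open import Data.Nat.Base
open import Data.Nat.Divisibility using (divides)
open import Data.Nat.Properties as ℕ hiding (_≟_)
open import Data.Nat.Tactic.RingSolver using (solve-∀)
open import Data.Product.Base using (Σ; Σ-syntax; _×_; _,_; proj₁; proj₂; uncurry)
open import Data.Product.Function.Dependent.Propositional using (Σ-↔)
open import Data.Product.Relation.Binary.Pointwise.NonDependent using (_×ₛ_)
open import Data.Sum.Base using (_⊎_; inj₁; inj₂; [_,_])
open import Data.Vec.Functional using (_∷_; foldr)
open import Function.Base using (_∘_; id; case_of_)
open import Function.Bundles using (_↔_; _⇔_; Inverse; Equivalence; mk↔ₛ′)
import Function.Construct.Composition as Comp
open import Function.Construct.Composition using (_↔-∘_)
import Function.Construct.Identity as Identity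
open import Function.Construct.Identity using (↔-id)
import Function.Construct.Symmetry as Symm
open import Function.Construct.Symmetry using (↔-sym)
open import Level using (0ℓ)
open import Relation.Binary.Bundles using (Setoid)
open import Relation.Binary.PropositionalEquality hiding ([_])
open import Relation.Nullary.Decidable
open import Relation.Nullary.Negation using (¬_; contradiction)
open import Relation.Unary using (Decidable)

open Graph using (V; size; index)
open Algebra.Properties.Semiring.Sum +-*-semiring
  using (sum; sum-cong-≗; ∑-comm; ∑-distrib-+; sum-permute; *-distribˡ-sum; *-distribʳ-sum)

-- Indicators of decidable propositions and finite sums.

𝟙 : Bool → ℕ
𝟙 b = if b then 1 else 0

⟦_⟧ : {P : Set} → Dec P → ℕ
⟦ d ⟧ = 𝟙 (does d)

⟦⟧-mono : {P Q : Set} (p : Dec P) (q : Dec Q) → (P → Q) → ⟦ p ⟧ ≤ ⟦ q ⟧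
⟦⟧-mono (no _)  _       _ = z≤n
⟦⟧-mono (yes _) (yes _) _ = ≤-refl
⟦⟧-mono (yes p) (no ¬q) f = contradiction (f p) ¬q

⟦⟧-cong : {P Q : Set} (p : Dec P) (q : Dec Q) → (P → Q) → (Q → P) → ⟦ p ⟧ ≡ ⟦ q ⟧
⟦⟧-cong p q f g = ≤-antisym (⟦⟧-mono p q f) (⟦⟧-mono q p g)

⟦⟧-× : {P Q : Set} (p : Dec P) (q : Dec Q) → ⟦ p ×-dec q ⟧ ≡ ⟦ p ⟧ * ⟦ q ⟧
⟦⟧-× (no _)  _       = refl
⟦⟧-× (yes _) (no _)  = refl
⟦⟧-× (yes _) (yes _) = refl

⟦⟧-split : {P Q R : Set} (p : Dec P) (q : Dec Q) (r : Dec R) →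
  (P → Q × R) → (Q → R → P) → ⟦ p ⟧ ≡ ⟦ q ⟧ * ⟦ r ⟧
⟦⟧-split p q r f g = trans (⟦⟧-cong p (q ×-dec r) f (uncurry g)) (⟦⟧-× q r)

⟦⟧-yes : {P : Set} (p : Dec P) → P → ⟦ p ⟧ ≡ 1
⟦⟧-yes (yes _) _ = refl
⟦⟧-yes (no ¬p) p = contradiction p ¬p

⟦⟧-no : {P : Set} (p : Dec P) → ¬ P → ⟦ p ⟧ ≡ 0
⟦⟧-no (no _)  _  = refl
⟦⟧-no (yes p) ¬p = contradiction p ¬p

sum-mono-≤ : ∀ {n} {f g : Fin n → ℕ} → (∀ i → f i ≤ g i) → sum f ≤ sum g
sum-mono-≤ {zero}  _   = z≤n
sum-mono-≤ {suc n} f≤g = +-mono-≤ (f≤g zero) (sum-mono-≤ (f≤g ∘ suc))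

length-filter-tabulate : ∀ {n} {A : Set} {P : A → Set} (P? : Decidable P) (f : Fin n → A) →
  length (filter P? (tabulate f)) ≡ sum (λ i → ⟦ P? (f i) ⟧)
length-filter-tabulate {zero}  P? f = refl
length-filter-tabulate {suc n} P? f with P? (f zero)
... | yes _ = cong suc (length-filter-tabulate P? (f ∘ suc))
... | no _  = length-filter-tabulate P? (f ∘ suc)

sum-↑ : ∀ m {n} (f : Fin (m + n) → ℕ) → sum f ≡ sum (f ∘ (_↑ˡ n)) + sum (f ∘ (m ↑ʳ_))
sum-↑ zero    f = refl
sum-↑ (suc m) f = trans (cong (f zero +_) (sum-↑ m (f ∘ suc))) (sym (+-assoc (f zero) _ _))

sum-combine : ∀ m {n} (f : Fin (m * n) → ℕ) → sum f ≡ sum {m} (λ i → sum {n} (λ j → f (combine i j)))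
sum-combine zero        f = refl
sum-combine (suc m) {n} f =
  trans (sum-↑ n f) (cong (sum (f ∘ (_↑ˡ m * n)) +_) (sum-combine m (f ∘ (n ↑ʳ_))))

-- Summation over finite setoids

-- Colourings are functions, and without function extensionality they can be enumerated only up to
-- pointwise equality; hence finiteness is stated for setoids.
record Finite (S : Setoid 0ℓ 0ℓ) : Set where
  field
    card        : ℕ
    enumeration : Inverse S (setoid (Fin card))
  open Inverse enumeration public using (to; from)

opaque
  ∑⟨_⟩ : {S : Setoid 0ℓ 0ℓ} → Finite S → (Setoid.Carrier S → ℕ) → ℕ
  ∑⟨ F ⟩ φ = sum (φ ∘ Finite.from F)

module _ {S : Setoid 0ℓ 0ℓ} (F : Finite S) where
  open Setoid S using (Carrier)

  opaque
    unfolding ∑⟨_⟩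

    ∑-cong : {φ ψ : Carrier → ℕ} → (∀ s → φ s ≡ ψ s) → ∑⟨ F ⟩ φ ≡ ∑⟨ F ⟩ ψ
    ∑-cong φ≡ψ = sum-cong-≗ (φ≡ψ ∘ Finite.from F)

    ∑-mono : {φ ψ : Carrier → ℕ} → (∀ s → φ s ≤ ψ s) → ∑⟨ F ⟩ φ ≤ ∑⟨ F ⟩ ψ
    ∑-mono φ≤ψ = sum-mono-≤ (φ≤ψ ∘ Finite.from F)

    ∑-*ˡ : (a : ℕ) (φ : Carrier → ℕ) → a * ∑⟨ F ⟩ φ ≡ ∑⟨ F ⟩ (λ s → a * φ s)
    ∑-*ˡ a φ = *-distribˡ-sum a (φ ∘ Finite.from F)

    ∑-*ʳ : (a : ℕ) (φ : Carrier → ℕ) → ∑⟨ F ⟩ φ * a ≡ ∑⟨ F ⟩ (λ s → φ s * a)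
    ∑-*ʳ a φ = *-distribʳ-sum a (φ ∘ Finite.from F)

    ∑-sum : ∀ {n} (φ : Carrier → Fin n → ℕ) →
      ∑⟨ F ⟩ (λ s → sum (φ s)) ≡ sum (λ i → ∑⟨ F ⟩ (λ s → φ s i))
    ∑-sum φ = ∑-comm (φ ∘ Finite.from F)

    -- Over an empty index set both sums vanish, so a comparison may assume a point. In
    -- `replaceWeights` the hypothesis on a slice takes a full family, including a value at the
    -- coordinate that varies.
    ∑-inhabited : {φ ψ : Carrier → ℕ} → (Carrier → ∑⟨ F ⟩ φ ≤ ∑⟨ F ⟩ ψ) → ∑⟨ F ⟩ φ ≤ ∑⟨ F ⟩ ψ
    ∑-inhabited {φ} {ψ} h = nonempty (φ ∘ Finite.from F) (ψ ∘ Finite.from F) (h ∘ Finite.from F)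
      where
      nonempty : ∀ {n} (f g : Fin n → ℕ) → (Fin n → sum f ≤ sum g) → sum f ≤ sum g
      nonempty {zero}  f g h = z≤n
      nonempty {suc _} f g h = h zero

module _ {S T : Setoid 0ℓ 0ℓ} (F : Finite S) (G : Finite T) where
  private
    module F = Finite F
    module G = Finite G
    module S = Setoid S
    module T = Setoid T

  opaque
    unfolding ∑⟨_⟩

    ∑-swap : (φ : S.Carrier → T.Carrier → ℕ) →
      ∑⟨ F ⟩ (λ s → ∑⟨ G ⟩ (φ s)) ≡ ∑⟨ G ⟩ (λ t → ∑⟨ F ⟩ (λ s → φ s t))
    ∑-swap φ = ∑-comm (λ i j → φ (F.from i) (G.from j))

    ∑-product : (φ : S.Carrier → ℕ) (ψ : T.Carrier → ℕ) →
      ∑⟨ F ⟩ φ * ∑⟨ G ⟩ ψ ≡ ∑⟨ F ⟩ (λ s → ∑⟨ G ⟩ (λ t → φ s * ψ t))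
    ∑-product φ ψ = trans (∑-*ʳ F _ φ) (∑-cong F λ s → ∑-*ˡ G (φ s) ψ)

    ∑-bijection : (I : Inverse S T) {φ : T.Carrier → ℕ} → (∀ {t t′} → t T.≈ t′ → φ t ≡ φ t′) →
      ∑⟨ F ⟩ (φ ∘ Inverse.to I) ≡ ∑⟨ G ⟩ φ
    ∑-bijection I {φ} φ-cong = sym (trans (sum-permute (φ ∘ G.from) π)
      (sum-cong-≗ λ i → φ-cong (Inverse.strictlyInverseʳ G.enumeration (Inverse.to I (F.from i)))))
      where
      π : Fin F.card ↔ Fin G.card
      π = Comp.inverse (Symm.inverse F.enumeration) (Comp.inverse I G.enumeration)

  infixr 2 _×ᶠ_
  _×ᶠ_ : Finite (S ×ₛ T)
  _×ᶠ_ = record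
    { card = F.card * G.card
    ; enumeration = record
      { to        = λ (s , t) → combine (F.to s) (G.to t)
      ; from      = λ k → F.from (proj₁ (remQuot {F.card} G.card k)) , G.from (proj₂ (remQuot {F.card} G.card k))
      ; to-cong   = λ (p , q) → cong₂ combine (Inverse.to-cong F.enumeration p) (Inverse.to-cong G.enumeration q)
      ; from-cong = λ { refl → S.refl , T.refl }
      ; inverse   =
          (λ {k} (p , q) → trans
            (cong₂ combine (Inverse.inverseˡ F.enumeration p) (Inverse.inverseˡ G.enumeration q))
            (combine-remQuot {F.card} G.card k)) ,
          (λ { {s , t} refl →
            S.trans (Inverse.from-cong F.enumeration (cong proj₁ (remQuot-combine (F.to s) (G.to t))))
              (Inverse.strictlyInverseʳ F.enumeration s) ,
            T.trans (Inverse.from-cong G.enumeration (cong proj₂ (remQuot-combine (F.to s) (G.to t))))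
              (Inverse.strictlyInverseʳ G.enumeration t) })
      }
    }

  opaque
    unfolding ∑⟨_⟩

    ∑-× : (φ : S.Carrier × T.Carrier → ℕ) →
      ∑⟨ _×ᶠ_ ⟩ φ ≡ ∑⟨ F ⟩ (λ s → ∑⟨ G ⟩ (λ t → φ (s , t)))
    ∑-× φ = trans (sum-combine F.card (φ ∘ Finite.from _×ᶠ_))
      (sum-cong-≗ λ i → sum-cong-≗ λ j →
        cong (λ (k , l) → φ (F.from k , G.from l)) (remQuot-combine i j))

-- Sums over colourings.

module _ {q : ℕ} where

  Colouring : Set → Setoid 0ℓ 0ℓ
  Colouring V = V →-setoid Fin q

  -- The encoding by `finToFun` is the one in `vertexMap`, so that in `hom-∑` the enumerated maps
  -- agree definitionally with those counted by `hom`.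
  finite-colouring : ∀ {V n} → V ↔ Fin n → Finite (Colouring V)
  finite-colouring {n = n} ix = record
    { card = q ^ n
    ; enumeration = record
      { to        = λ f → funToFin (f ∘ Inverse.from ix)
      ; from      = λ k → finToFun k ∘ Inverse.to ix
      ; to-cong   = λ f≗g → funToFin-cong (f≗g ∘ Inverse.from ix)
      ; from-cong = λ { refl _ → refl }
      ; inverse   =
          (λ {k} f≗k → trans
            (funToFin-cong λ i → trans (f≗k (Inverse.from ix i)) (cong (finToFun k) (Inverse.strictlyInverseˡ ix i)))
            (funToFin-finToFin {n} k)) ,
          (λ { {f} refl v → trans (finToFun-funToFin (f ∘ Inverse.from ix) (Inverse.to ix v))
            (cong f (Inverse.strictlyInverseʳ ix v)) })
      }
    }
    where
    funToFin-cong : ∀ {m} {f g : Fin m → Fin q} → f ≗ g → funToFin f ≡ funToFin g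
    funToFin-cong {zero}  _   = refl
    funToFin-cong {suc m} f≗g = cong₂ combine (f≗g zero) (funToFin-cong (f≗g ∘ suc))

  ∑ᶜ : ∀ {V n} → V ↔ Fin n → ((V → Fin q) → ℕ) → ℕ
  ∑ᶜ ix = ∑⟨ finite-colouring ix ⟩

  Extensional : {V : Set} → ((V → Fin q) → ℕ) → Set
  Extensional φ = ∀ {f g} → f ≗ g → φ f ≡ φ g

  reindex : {V W : Set} → V ↔ W → Inverse (Colouring V) (Colouring W)
  reindex b = record
    { to        = _∘ Inverse.from b
    ; from      = _∘ Inverse.to b
    ; to-cong   = λ f≗g → f≗g ∘ Inverse.from b
    ; from-cong = λ f≗g → f≗g ∘ Inverse.to b
    ; inverse   =
        (λ {g} f≗g w → trans (f≗g _) (cong g (Inverse.strictlyInverseˡ b w))) ,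
        (λ {f} g≗f v → trans (g≗f _) (cong f (Inverse.strictlyInverseʳ b v)))
    }

  ∑-reindex : ∀ {V W m n} (ix : V ↔ Fin m) (iy : W ↔ Fin n) (b : V ↔ W) {φ : (V → Fin q) → ℕ} →
    Extensional φ → ∑ᶜ ix φ ≡ ∑ᶜ iy (φ ∘ (_∘ Inverse.to b))
  ∑-reindex ix iy b φ-ext =
    sym (∑-bijection (finite-colouring iy) (finite-colouring ix) (Symm.inverse (reindex b)) φ-ext)

  copair : {V W : Set} → Inverse (Colouring V ×ₛ Colouring W) (Colouring (V ⊎ W))
  copair = record
    { to        = λ (f , g) → [ f , g ]
    ; from      = λ h → h ∘ inj₁ , h ∘ inj₂
    ; to-cong   = λ { (p , q) (inj₁ v) → p v ; (p , q) (inj₂ w) → q w }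
    ; from-cong = λ p → p ∘ inj₁ , p ∘ inj₂
    ; inverse   =
        (λ { (p , q) (inj₁ v) → p v ; (p , q) (inj₂ w) → q w }) ,
        (λ p → p ∘ inj₁ , p ∘ inj₂)
    }

  ∑-⊎ : ∀ {V W m n k} (ix : V ↔ Fin m) (iy : W ↔ Fin n) (iz : (V ⊎ W) ↔ Fin k) {φ} →
    Extensional φ → ∑ᶜ iz φ ≡ ∑ᶜ ix (λ f → ∑ᶜ iy (λ g → φ [ f , g ]))
  ∑-⊎ ix iy iz {φ} φ-ext = trans
    (sym (∑-bijection (finite-colouring ix ×ᶠ finite-colouring iy) (finite-colouring iz) copair φ-ext))
    (∑-× (finite-colouring ix) (finite-colouring iy) (λ (f , g) → φ [ f , g ]))

  ∑ⁿ : ∀ n → ((Fin n → Fin q) → ℕ) → ℕ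
  ∑ⁿ n = ∑ᶜ (↔-id (Fin n))

  opaque
    unfolding ∑⟨_⟩

    ∑-∷ : ∀ n {φ : (Fin (suc n) → Fin q) → ℕ} → Extensional φ →
      ∑ⁿ (suc n) φ ≡ sum (λ c → ∑ⁿ n (λ f → φ (c ∷ f)))
    ∑-∷ n φ-ext = trans (sum-combine q _) (sum-cong-≗ λ c → sum-cong-≗ λ k → φ-ext λ
      { zero    → cong proj₁ (remQuot-combine c k)
      ; (suc i) → cong (λ p → finToFun (proj₂ p) i) (remQuot-combine c k)
      })

    ∑-[] : (φ : (Fin 0 → Fin q) → ℕ) → Extensional φ → (f : Fin 0 → Fin q) → ∑ⁿ 0 φ ≡ φ f
    ∑-[] φ φ-ext f = trans (+-identityʳ _) (φ-ext λ ())

  -- The bipartite swapping trick.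
  select : {V : Set} → (V → Bool) → (V → Fin q) → (V → Fin q) → V → Fin q
  select side f g v = if side v then f v else g v

  exchange : {V : Set} → (V → Bool) → Inverse (Colouring V ×ₛ Colouring V) (Colouring V ×ₛ Colouring V)
  exchange {V} side = record
    { to        = swapped
    ; from      = swapped
    ; to-cong   = swapped-cong
    ; from-cong = swapped-cong
    ; inverse   = (λ {p} e → S.trans (swapped-cong e) (involutive p)) ,
                  (λ {p} e → S.trans (swapped-cong e) (involutive p))
    }
    where
    module S = Setoid (Colouring V ×ₛ Colouring V)
    swapped : S.Carrier → S.Carrier
    swapped (f , g) = select side f g , select side g f
    select-cong : ∀ {f f′ g g′} → f ≗ f′ → g ≗ g′ → select side f g ≗ select side f′ g′
    select-cong p q v = cong₂ (if side v then_else_) (p v) (q v)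
    swapped-cong : ∀ {p p′} → p S.≈ p′ → swapped p S.≈ swapped p′
    swapped-cong (p , q) = select-cong p q , select-cong q p
    select-select : ∀ f g → select side (select side f g) (select side g f) ≗ f
    select-select f g v with side v
    ... | true  = refl
    ... | false = refl
    involutive : ∀ p → swapped (swapped p) S.≈ p
    involutive (f , g) = select-select f g , select-select g f

  Extensional₂ : {V W : Set} → ((V → Fin q) → (W → Fin q) → ℕ) → Set
  Extensional₂ φ = ∀ {f f′ g g′} → f ≗ f′ → g ≗ g′ → φ f g ≡ φ f′ g′

  -- Exchanging `f` and `g` at the vertices where `side` is false is an involution on pairs, hence a
  -- permutation of the summands.
  ∑-exchange : ∀ {V n} (ix : V ↔ Fin n) (side : V → Bool) {φ : (V → Fin q) → (V → Fin q) → ℕ} →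
    Extensional₂ φ →
    ∑ᶜ ix (λ f → ∑ᶜ ix (φ f)) ≡ ∑ᶜ ix (λ f → ∑ᶜ ix (λ g → φ (select side f g) (select side g f)))
  ∑-exchange ix side {φ} φ-ext = begin
    ∑ᶜ ix (λ f → ∑ᶜ ix (φ f))
      ≡⟨ ∑-× F F (uncurry φ) ⟨
    ∑⟨ F ×ᶠ F ⟩ (uncurry φ)
      ≡⟨ ∑-bijection (F ×ᶠ F) (F ×ᶠ F) (exchange side) {uncurry φ} (uncurry φ-ext) ⟨
    ∑⟨ F ×ᶠ F ⟩ (uncurry φ ∘ Inverse.to (exchange side))
      ≡⟨ ∑-× F F (uncurry φ ∘ Inverse.to (exchange side)) ⟩
    ∑ᶜ ix (λ f → ∑ᶜ ix (λ g → φ (select side f g) (select side g f))) ∎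
    where
    open ≡-Reasoning
    F = finite-colouring ix

∀-dec : ∀ {V : Set} {n} {P : V → Set} → V ↔ Fin n → (∀ v → Dec (P v)) → Dec (∀ v → P v)
∀-dec {P = P} ix P? = map′
  (λ h v → subst P (Inverse.strictlyInverseʳ ix v) (h (Inverse.to ix v)))
  (λ h i → h (Inverse.from ix i))
  (all? (P? ∘ Inverse.from ix))

-- Dependent products of finite setoids.

∏ : ∀ {n} → (Fin n → ℕ) → ℕ
∏ = foldr _*_ 1

Πₛ : ∀ {N} → (Fin N → Setoid 0ℓ 0ℓ) → Setoid 0ℓ 0ℓ
Πₛ S = record
  { Carrier       = ∀ i → Setoid.Carrier (S i)
  ; _≈_           = λ r s → ∀ i → Setoid._≈_ (S i) (r i) (s i)
  ; isEquivalence = record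
    { refl  = λ i → Setoid.refl (S i)
    ; sym   = λ p i → Setoid.sym (S i) (p i)
    ; trans = λ p q i → Setoid.trans (S i) (p i) (q i)
    }
  }

module _ {N} {S : Fin (suc N) → Set} where

  infixr 5 _∷ᵈ_
  _∷ᵈ_ : S zero → (∀ i → S (suc i)) → ∀ i → S i
  (s ∷ᵈ r) zero    = s
  (s ∷ᵈ r) (suc i) = r i

infixl 6 _[_≔_]
-- Recursion on the position avoids transporting `s` along an equality of indices, and makes updates
-- at `suc i` commute definitionally with `_∷ᵈ_`.
_[_≔_] : ∀ {N} {S : Fin N → Set} → (∀ i → S i) → ∀ i → S i → ∀ j → S j
r [ zero  ≔ s ] = s ∷ᵈ r ∘ suc
r [ suc i ≔ s ] = r zero ∷ᵈ (r ∘ suc) [ i ≔ s ]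

≔-same : ∀ {N} {S : Fin N → Set} (r : ∀ i → S i) i s → (r [ i ≔ s ]) i ≡ s
≔-same r zero    s = refl
≔-same r (suc i) s = ≔-same (r ∘ suc) i s

≔-other : ∀ {N} {S : Fin N → Set} (r : ∀ i → S i) i s {j} → j ≢ i → (r [ i ≔ s ]) j ≡ r j
≔-other r zero    s {zero}  j≢i = contradiction refl j≢i
≔-other r zero    s {suc j} j≢i = refl
≔-other r (suc i) s {zero}  j≢i = refl
≔-other r (suc i) s {suc j} j≢i = ≔-other (r ∘ suc) i s (j≢i ∘ cong suc)

uncons : ∀ {N} (S : Fin (suc N) → Setoid 0ℓ 0ℓ) → Inverse (Πₛ S) (S zero ×ₛ Πₛ (S ∘ suc))
uncons S = record
  { to        = λ r → r zero , r ∘ suc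
  ; from      = λ (s , r) → s ∷ᵈ r
  ; to-cong   = λ p → p zero , p ∘ suc
  ; from-cong = λ { (p , q) zero → p ; (p , q) (suc i) → q i }
  ; inverse   = (λ p → p zero , p ∘ suc) ,
                (λ { (p , q) zero → p ; (p , q) (suc i) → q i })
  }

finite-Π : ∀ {N} {S : Fin N → Setoid 0ℓ 0ℓ} → (∀ i → Finite (S i)) → Finite (Πₛ S)
finite-Π {zero}  F = record
  { card = 1
  ; enumeration = record
    { to        = λ _ → zero
    ; from      = λ _ ()
    ; to-cong   = λ _ → refl
    ; from-cong = λ _ ()
    ; inverse   = (λ { {zero} _ → refl }) , λ _ ()
    }
  }
finite-Π {suc N} {S} F = record
  { enumeration = Comp.inverse (uncons S) (Finite.enumeration (F zero ×ᶠ finite-Π (F ∘ suc))) }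

opaque
  unfolding ∑⟨_⟩

  ∑-Π-suc : ∀ {N} {S : Fin (suc N) → Setoid 0ℓ 0ℓ} (F : ∀ i → Finite (S i)) φ →
    ∑⟨ finite-Π F ⟩ φ ≡ ∑⟨ F zero ⟩ (λ s → ∑⟨ finite-Π (F ∘ suc) ⟩ (λ r → φ (s ∷ᵈ r)))
  ∑-Π-suc F φ = ∑-× (F zero) (finite-Π (F ∘ suc)) (λ (s , r) → φ (s ∷ᵈ r))

-- The weights are exchanged one coordinate at a time, the others being held fixed.
replaceWeights : ∀ {N} {S : Fin N → Setoid 0ℓ 0ℓ} (F : ∀ i → Finite (S i))
  (w w′ : ∀ i → Setoid.Carrier (S i) → ℕ) (Φ : (∀ i → Setoid.Carrier (S i)) → ℕ) →
  (∀ i r → ∑⟨ F i ⟩ (λ s → w i s * Φ (r [ i ≔ s ])) ≤ ∑⟨ F i ⟩ (λ s → w′ i s * Φ (r [ i ≔ s ]))) →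
  ∑⟨ finite-Π F ⟩ (λ r → ∏ (λ i → w i (r i)) * Φ r) ≤
  ∑⟨ finite-Π F ⟩ (λ r → ∏ (λ i → w′ i (r i)) * Φ r)
replaceWeights {zero}  F w w′ Φ slice = ≤-refl
replaceWeights {suc N} {S} F w w′ Φ slice = begin
  ∑⟨ finite-Π F ⟩ (λ r → ∏ (λ i → w i (r i)) * Φ r)
    ≡⟨ ∑-Π-suc F _ ⟩
  ∑⟨ F₀ ⟩ (λ s → ∑⟨ F₊ ⟩ (λ r → (w zero s * W r) * Φ (s ∷ᵈ r)))
    ≡⟨ ∑-cong F₀ (λ s → trans (∑-cong F₊ λ r → *-assoc (w zero s) (W r) _) (sym (∑-*ˡ F₊ (w zero s) _))) ⟩
  ∑⟨ F₀ ⟩ (λ s → w zero s * ∑⟨ F₊ ⟩ (λ r → W r * Φ (s ∷ᵈ r)))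
    -- The induction hypothesis replaces the tail weights below a fixed head `s`. Afterwards `pull`
    -- makes the sum over the head innermost, where the slice at `zero` applies.
    ≤⟨ ∑-mono F₀ (λ s → *-monoʳ-≤ (w zero s)
         (replaceWeights (F ∘ suc) (w ∘ suc) (w′ ∘ suc) (λ r → Φ (s ∷ᵈ r)) (λ i r → slice (suc i) (s ∷ᵈ r)))) ⟩
  ∑⟨ F₀ ⟩ (λ s → w zero s * ∑⟨ F₊ ⟩ (λ r → W′ r * Φ (s ∷ᵈ r)))
    ≡⟨ pull w ⟩
  ∑⟨ F₊ ⟩ (λ r → W′ r * ∑⟨ F₀ ⟩ (λ s → w zero s * Φ (s ∷ᵈ r)))
    ≤⟨ ∑-mono F₊ (λ r → *-monoʳ-≤ (W′ r) (∑-inhabited F₀ λ s → slice zero (s ∷ᵈ r))) ⟩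
  ∑⟨ F₊ ⟩ (λ r → W′ r * ∑⟨ F₀ ⟩ (λ s → w′ zero s * Φ (s ∷ᵈ r)))
    ≡⟨ pull w′ ⟨
  ∑⟨ F₀ ⟩ (λ s → w′ zero s * ∑⟨ F₊ ⟩ (λ r → W′ r * Φ (s ∷ᵈ r)))
    ≡⟨ ∑-cong F₀ (λ s → trans (∑-cong F₊ λ r → *-assoc (w′ zero s) (W′ r) _) (sym (∑-*ˡ F₊ (w′ zero s) _))) ⟨
  ∑⟨ F₀ ⟩ (λ s → ∑⟨ F₊ ⟩ (λ r → (w′ zero s * W′ r) * Φ (s ∷ᵈ r)))
    ≡⟨ ∑-Π-suc F _ ⟨
  ∑⟨ finite-Π F ⟩ (λ r → ∏ (λ i → w′ i (r i)) * Φ r) ∎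
  where
  open ≤-Reasoning
  F₀ = F zero
  F₊ = finite-Π (F ∘ suc)
  W W′ : (∀ i → Setoid.Carrier (S (suc i))) → ℕ
  W r  = ∏ (λ i → w (suc i) (r i))
  W′ r = ∏ (λ i → w′ (suc i) (r i))
  exchange-* : ∀ a b c → a * (b * c) ≡ b * (a * c)
  exchange-* = solve-∀
  pull : ∀ (v : ∀ i → Setoid.Carrier (S i) → ℕ) →
    ∑⟨ F₀ ⟩ (λ s → v zero s * ∑⟨ F₊ ⟩ (λ r → W′ r * Φ (s ∷ᵈ r))) ≡
    ∑⟨ F₊ ⟩ (λ r → W′ r * ∑⟨ F₀ ⟩ (λ s → v zero s * Φ (s ∷ᵈ r)))
  pull v = trans
    (∑-cong F₀ λ s → trans (∑-*ˡ F₊ (v zero s) _) (∑-cong F₊ λ r → exchange-* (v zero s) (W′ r) _))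
    (trans (∑-swap F₀ F₊ _) (∑-cong F₊ λ r → sym (∑-*ˡ F₀ (W′ r) _)))

-- Colourings of a blow-up

Palette : ℕ → Set
Palette q = Fin q → Bool

∏-⟦⟧ : ∀ {n} {P : Fin n → Set} (P? : ∀ i → Dec (P i)) → ∏ (λ i → ⟦ P? i ⟧) ≡ ⟦ all? P? ⟧
∏-⟦⟧ {zero}  P? = sym (⟦⟧-yes (all? P?) λ ())
∏-⟦⟧ {suc n} P? = trans (cong (⟦ P? zero ⟧ *_) (∏-⟦⟧ (P? ∘ suc)))
  (sym (⟦⟧-split (all? P?) (P? zero) (all? (P? ∘ suc))
    (λ h → h zero , h ∘ suc) (λ { p h zero → p ; p h (suc i) → h i })))

module _ {q : ℕ} where

  Within : {V : Set} → Palette q → (V → Fin q) → Set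
  Within X f = ∀ v → T (X (f v))

  within? : ∀ {V n} → V ↔ Fin n → ∀ X (f : V → Fin q) → Dec (Within X f)
  within? ix X f = ∀-dec ix λ v → T? (X (f v))

  Within-resp : ∀ {V} X {f g : V → Fin q} → f ≗ g → Within X f → Within X g
  Within-resp X p h v = subst (T ∘ X) (p v) (h v)

  Disjoint : {V W : Set} → (V → Fin q) → (W → Fin q) → Set
  Disjoint f g = ∀ x y → f x ≢ g y

  disjoint? : ∀ {V W m n} → V ↔ Fin m → W ↔ Fin n → ∀ (f : V → Fin q) (g : W → Fin q) → Dec (Disjoint f g)
  disjoint? ix iy f g = ∀-dec ix λ x → ∀-dec iy λ y → ¬? (f x ≟ g y)

  module _ (G : Graph) where
    open Graph G using (_~_; _~?_; ~-sym)

    ∑ᴳ : ((V G → Fin q) → ℕ) → ℕ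
    ∑ᴳ = ∑ᶜ (index G)

    -- With `f` on the first copy of the vertices and `g` on the second, this is properness on
    -- `G ×ᵍ K 2`; with `g` equal to `f` it is properness on `G`. One relation thus serves both
    -- counts.
    Cross : (V G → Fin q) → (V G → Fin q) → Set
    Cross f g = ∀ u v → u ~ v → f u ≢ g v

    cross? : ∀ f g → Dec (Cross f g)
    cross? f g = ∀-dec (index G) λ u → ∀-dec (index G) λ v → (u ~? v) →-dec ¬? (f u ≟ g v)

    Cross-resp : ∀ {f f′ g g′} → f ≗ f′ → g ≗ g′ → Cross f g → Cross f′ g′
    Cross-resp p q c u v e = subst₂ _≢_ (p u) (q v) (c u v e)

    Cross-sym : ∀ {f g} → Cross f g → Cross g f
    Cross-sym c u v e = c v u (~-sym e) ∘ sym

    cross-ext : Extensional₂ (λ f g → ⟦ cross? f g ⟧)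
    cross-ext p q = ⟦⟧-cong (cross? _ _) (cross? _ _)
      (Cross-resp p q) (Cross-resp (sym ∘ p) (sym ∘ q))

    fits : Palette q → (V G → Fin q) → ℕ
    fits X f = ⟦ within? (index G) X f ⟧

    proper : (V G → Fin q) → ℕ
    proper f = ⟦ cross? f f ⟧

    cross : (V G → Fin q) → (V G → Fin q) → ℕ
    cross f g = ⟦ cross? f g ⟧

    χ : Palette q → ℕ
    χ X = ∑ᴳ (λ f → fits X f * proper f)

    χ₂ : Palette q → Palette q → ℕ
    χ₂ X Y = ∑ᴳ (λ f → ∑ᴳ (λ g → (fits X f * fits Y g) * cross f g))

-- The list version of the inequality; unlike the inequality itself it can be applied to one part of a
-- blow-up at a time, X and Y being the colours that the neighbouring parts leave free.
Good : ℕ → Graph → Set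
Good q G = ∀ (X Y : Palette q) → χ G X * χ G Y ≤ χ₂ G X Y

opaque
  unfolding ∑⟨_⟩

  hom-∑ : ∀ G q → hom G (K q) ≡ ∑ᴳ {q} G (proper G)
  hom-∑ G q = trans (length-filter-tabulate (isHom? G (K q) ∘ vertexMap G (K q)) id)
    (∑-cong (finite-colouring (index G)) λ f → ⟦⟧-cong (isHom? G (K q) f) (cross? G f f) id id)

-- Colourings of the tensor product with `K 2`.

module _ {V : Set} {q : ℕ} where

  pairing : Inverse (Colouring {q} V ×ₛ Colouring V) (Colouring (V × Fin 2))
  pairing = record
    { to        = λ { (f , g) (v , zero) → f v ; (f , g) (v , suc zero) → g v }
    ; from      = λ h → (λ v → h (v , zero)) , (λ v → h (v , suc zero))
    ; to-cong   = λ { (p , q) (v , zero) → p v ; (p , q) (v , suc zero) → q v }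
    ; from-cong = λ p → (λ v → p (v , zero)) , (λ v → p (v , suc zero))
    ; inverse   =
        (λ { (p , q) (v , zero) → p v ; (p , q) (v , suc zero) → q v }) ,
        (λ p → (λ v → p (v , zero)) , (λ v → p (v , suc zero)))
    }

hom-×K₂ : ∀ G q → hom (G ×ᵍ K 2) (K q) ≡ ∑ᴳ {q} G (λ f → ∑ᴳ G (cross G f))
hom-×K₂ G q = begin
  hom (G ×ᵍ K 2) (K q)                           ≡⟨ hom-∑ (G ×ᵍ K 2) q ⟩
  ∑ᴳ (G ×ᵍ K 2) (proper (G ×ᵍ K 2))              ≡⟨ ∑-bijection (F ×ᶠ F) _ pairing (λ p → cross-ext (G ×ᵍ K 2) p p) ⟨
  ∑⟨ F ×ᶠ F ⟩ (proper (G ×ᵍ K 2) ∘ Inverse.to pairing)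
    ≡⟨ ∑-cong (F ×ᶠ F) (λ (f , g) → ⟦⟧-cong (cross? (G ×ᵍ K 2) _ _) (cross? G f g)
         (λ c u v e → c (u , zero) (v , suc zero) (e , λ ())) (joint f g)) ⟩
  ∑⟨ F ×ᶠ F ⟩ (uncurry (cross G))                ≡⟨ ∑-× F F (uncurry (cross G)) ⟩
  ∑ᴳ G (λ f → ∑ᴳ G (cross G f))                  ∎
  where
  open ≡-Reasoning
  F = finite-colouring {q} (index G)
  joint : ∀ f g → Cross G f g → Cross (G ×ᵍ K 2) (Inverse.to pairing (f , g)) (Inverse.to pairing (f , g))
  joint f g c (u , zero)     (v , zero)     (e , i≢j) = contradiction refl i≢j
  joint f g c (u , zero)     (v , suc zero) (e , i≢j) = c u v e
  joint f g c (u , suc zero) (v , zero)     (e , i≢j) = Cross-sym G c u v e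
  joint f g c (u , suc zero) (v , suc zero) (e , i≢j) = contradiction refl i≢j

-- Reduction of a blow-up to its parts.

module BlowUpColouring (q : ℕ) (F : Graph) (Hs : V F → Graph) where
  private
    module F = Graph F

    N : ℕ
    N = size F

    A : Fin N → Graph
    A = Hs ∘ F.vertex

  -- Matching on the adjacency directly would have to unify `F.vertex k` with `F.vertex l`. It is
  -- therefore inverted at arbitrary positions first, and the resulting equation is pulled back to
  -- the indices.
  BlowUpAdj⁻¹ : ∀ {k l x y} → BlowUpAdj F Hs (F.vertex k , x) (F.vertex l , y) →
    (Σ[ e ∈ k ≡ l ] Graph._~_ (A l) (subst (V ∘ A) e x) y) ⊎ F.vertex k F.~ F.vertex l
  BlowUpAdj⁻¹ {k} {l} adj with invert adj
    where
    invert : ∀ {p p′} → BlowUpAdj F Hs p p′ →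
      (Σ[ e ∈ proj₁ p ≡ proj₁ p′ ] Graph._~_ (Hs (proj₁ p′)) (subst (V ∘ Hs) e (proj₂ p)) (proj₂ p′)) ⊎
      proj₁ p F.~ proj₁ p′
    invert (within e) = inj₁ (refl , e)
    invert (across e) = inj₂ e
  ... | inj₂ e = inj₂ e
  ... | inj₁ (e , a) with trans (sym (Inverse.strictlyInverseˡ F.index k))
                            (trans (cong (Inverse.to F.index) e) (Inverse.strictlyInverseˡ F.index l))
  ...   | refl with refl ← e = inj₁ (refl , a)

  Σ-vertex : Σ (Fin N) (V ∘ A) ↔ Σ (V F) (V ∘ Hs)
  Σ-vertex = Σ-↔ (↔-sym F.index) (↔-id _)

  module _ (H : Graph) (position : V H ↔ Σ (Fin N) (V ∘ A)) where
    private
      module H = Graph H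
      module A k = Graph (A k)
      module P = Inverse position

    part : V H → Fin N
    part = proj₁ ∘ P.to

    local : ∀ u → V (A (part u))
    local = proj₂ ∘ P.to

    Local : Fin N → Setoid 0ℓ 0ℓ
    Local k = Colouring {q} (V (A k)) ×ₛ Colouring {q} (V (A k))

    States : Setoid 0ℓ 0ℓ
    States = Πₛ Local

    finite-local : ∀ k → Finite (Local k)
    finite-local k = finite-colouring (A.index k) ×ᶠ finite-colouring (A.index k)

    glue : (∀ k → V (A k) → Fin q) → V H → Fin q
    glue f u = f (part u) (local u)

    gluing : Inverse States (Colouring {q} (V H) ×ₛ Colouring {q} (V H))
    gluing = record
      { to        = λ r → glue (proj₁ ∘ r) , glue (proj₂ ∘ r)
      ; from      = λ (f , g) k → restrict f k , restrict g k
      ; to-cong   = λ p → (λ u → proj₁ (p (part u)) (local u)) , (λ u → proj₂ (p (part u)) (local u))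
      ; from-cong = λ (p , q) k → (λ x → p (P.from (k , x))) , (λ x → q (P.from (k , x)))
      ; inverse   =
          (λ {(f , g)} p →
            (λ u → trans (proj₁ (p (part u)) (local u)) (cong f (P.strictlyInverseʳ u))) ,
            (λ u → trans (proj₂ (p (part u)) (local u)) (cong g (P.strictlyInverseʳ u)))) ,
          (λ {r} (p , q) k →
            (λ x → trans (p (P.from (k , x))) (restrict-glue (proj₁ ∘ r) k x)) ,
            (λ x → trans (q (P.from (k , x))) (restrict-glue (proj₂ ∘ r) k x)))
      }
      where
      restrict : (V H → Fin q) → ∀ k → V (A k) → Fin q
      restrict f k x = f (P.from (k , x))
      restrict-glue : ∀ f k x → restrict (glue f) k x ≡ f k x
      restrict-glue f k x = cong (uncurry f) (P.strictlyInverseˡ (k , x))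

    ∑-glue : {φ : (V H → Fin q) → (V H → Fin q) → ℕ} → Extensional₂ φ →
      ∑ᴳ H (λ f → ∑ᴳ H (φ f)) ≡ ∑⟨ finite-Π finite-local ⟩ (λ r → φ (glue (proj₁ ∘ r)) (glue (proj₂ ∘ r)))
    ∑-glue {φ} φ-ext = trans (sym (∑-× C C (uncurry φ)))
      (sym (∑-bijection (finite-Π finite-local) (C ×ᶠ C) gluing {uncurry φ} (uncurry φ-ext)))
      where C = finite-colouring H.index

    -- Parts adjacent in `F` are completely joined, so all the edges between them together say that
    -- two sets of colours are disjoint.
    Across : (∀ k → V (A k) → Fin q) → (∀ k → V (A k) → Fin q) → Set
    Across f g = ∀ k l → F.vertex k F.~ F.vertex l → Disjoint (f k) (g l)

    across? : ∀ f g → Dec (Across f g)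
    across? f g = all? λ k → all? λ l →
      (F.vertex k F.~? F.vertex l) →-dec disjoint? (A.index k) (A.index l) (f k) (g l)

    module _
      (~⇒adj : ∀ u v → u H.~ v → BlowUpAdj F Hs (F.vertex (part u) , local u) (F.vertex (part v) , local v))
      (adj⇒~ : ∀ p p′ → BlowUpAdj F Hs (F.vertex (proj₁ p) , proj₂ p) (F.vertex (proj₁ p′) , proj₂ p′) →
               P.from p H.~ P.from p′)
      (side : V F → Bool) (side-≢ : ∀ u v → u F.~ v → side u ≢ side v)
      where

      glue-cross : ∀ f g → (∀ k → Cross (A k) (f k) (g k)) → Across f g → Cross H (glue f) (glue g)
      glue-cross f g c a u v e = local-≢ (BlowUpAdj⁻¹ (~⇒adj u v e))
        where
        local-≢ : ∀ {k l x y} →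
          (Σ[ e ∈ k ≡ l ] A._~_ l (subst (V ∘ A) e x) y) ⊎ F.vertex k F.~ F.vertex l → f k x ≢ g l y
        local-≢ (inj₁ (refl , e)) = c _ _ _ e
        local-≢ (inj₂ e)          = a _ _ e _ _

      glue-≢ : ∀ f g {k x l y} → Cross H (glue f) (glue g) →
        BlowUpAdj F Hs (F.vertex k , x) (F.vertex l , y) → f k x ≢ g l y
      glue-≢ f g {k} {x} {l} {y} c e = subst₂ (λ (k , x) (l , y) → f k x ≢ g l y)
        (P.strictlyInverseˡ (k , x)) (P.strictlyInverseˡ (l , y)) (c _ _ (adj⇒~ (k , x) (l , y) e))

      cross-unglue : ∀ f g → Cross H (glue f) (glue g) → (∀ k → Cross (A k) (f k) (g k)) × Across f g
      cross-unglue f g c = (λ k x y e → glue-≢ f g c (within e)) , (λ k l e x y → glue-≢ f g c (across e))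

      State : Set
      State = Setoid.Carrier States

      -- This constraint between the parts is common to both counts: it arises directly from two
      -- proper colourings of `H`, and from a colouring of `H ×ᵍ K 2` after the exchange.
      Compatible : State → Set
      Compatible r = Across (proj₁ ∘ r) (proj₁ ∘ r) × Across (proj₂ ∘ r) (proj₂ ∘ r)

      compatible? : ∀ r → Dec (Compatible r)
      compatible? r = across? (proj₁ ∘ r) (proj₁ ∘ r) ×-dec across? (proj₂ ∘ r) (proj₂ ∘ r)

      Φ : State → ℕ
      Φ r = ⟦ compatible? r ⟧

      straight crossed : ∀ k → Setoid.Carrier (Local k) → ℕ
      straight k (f , g) = ⟦ cross? (A k) f f ×-dec cross? (A k) g g ⟧
      crossed k (f , g) = cross (A k) f g

      hom²-states : hom H (K q) ^ 2 ≡ ∑⟨ finite-Π finite-local ⟩ (λ r → ∏ (λ k → straight k (r k)) * Φ r)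
      hom²-states = begin
        hom H (K q) ^ 2
          ≡⟨ cong (hom H (K q) *_) (*-identityʳ _) ⟩
        hom H (K q) * hom H (K q)
          ≡⟨ cong₂ _*_ (hom-∑ H q) (hom-∑ H q) ⟩
        ∑ᴳ H (proper H) * ∑ᴳ H (proper H)
          ≡⟨ ∑-product (finite-colouring H.index) (finite-colouring H.index) (proper H) (proper H) ⟩
        ∑ᴳ H (λ f → ∑ᴳ H (λ g → proper H f * proper H g))
          ≡⟨ ∑-glue (λ p q → cong₂ _*_ (cross-ext H p p) (cross-ext H q q)) ⟩
        ∑⟨ finite-Π finite-local ⟩ (λ r → proper H (glue (proj₁ ∘ r)) * proper H (glue (proj₂ ∘ r)))
          ≡⟨ ∑-cong (finite-Π finite-local) split ⟩
        ∑⟨ finite-Π finite-local ⟩ (λ r → ∏ (λ k → straight k (r k)) * Φ r) ∎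
        where
        open ≡-Reasoning
        split : ∀ r → proper H (glue (proj₁ ∘ r)) * proper H (glue (proj₂ ∘ r)) ≡ ∏ (λ k → straight k (r k)) * Φ r
        split r = trans (sym (⟦⟧-× f? g?)) (trans
          (⟦⟧-split (f? ×-dec g?) (all? s?) (compatible? r)
            (λ (c , d) → let (c₁ , c₂) = cross-unglue (proj₁ ∘ r) (proj₁ ∘ r) c ; (d₁ , d₂) = cross-unglue (proj₂ ∘ r) (proj₂ ∘ r) d in
              (λ k → c₁ k , d₁ k) , (c₂ , d₂))
            (λ h (a , b) → glue-cross (proj₁ ∘ r) (proj₁ ∘ r) (proj₁ ∘ h) a , glue-cross (proj₂ ∘ r) (proj₂ ∘ r) (proj₂ ∘ h) b))
          (cong (_* Φ r) (sym (∏-⟦⟧ s?))))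
          where
          f? = cross? H (glue (proj₁ ∘ r)) (glue (proj₁ ∘ r))
          g? = cross? H (glue (proj₂ ∘ r)) (glue (proj₂ ∘ r))
          s? = λ k → cross? (A k) (proj₁ (r k)) (proj₁ (r k)) ×-dec cross? (A k) (proj₂ (r k)) (proj₂ (r k))

      -- The exchange follows the sides of `F`. Adjacent parts lie on opposite sides, so the two
      -- crossed conditions between them become one condition on `f` alone and one on `g` alone.
      -- Inside a part both colourings are swapped together, and `Cross` survives by its symmetry.
      hom-×K₂-states : hom (H ×ᵍ K 2) (K q) ≡ ∑⟨ finite-Π finite-local ⟩ (λ r → ∏ (λ k → crossed k (r k)) * Φ r)
      hom-×K₂-states = begin
        hom (H ×ᵍ K 2) (K q)
          ≡⟨ hom-×K₂ H q ⟩
        ∑ᴳ H (λ f → ∑ᴳ H (cross H f))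
          ≡⟨ ∑-exchange H.index (side ∘ F.vertex ∘ part) (cross-ext H) ⟩
        ∑ᴳ H (λ f → ∑ᴳ H (λ g → cross H (select (side ∘ F.vertex ∘ part) f g) (select (side ∘ F.vertex ∘ part) g f)))
          ≡⟨ ∑-glue (λ p q → cross-ext H (select-cong p q) (select-cong q p)) ⟩
        ∑⟨ finite-Π finite-local ⟩ (λ r → cross H (glue (sel (proj₁ ∘ r) (proj₂ ∘ r))) (glue (sel (proj₂ ∘ r) (proj₁ ∘ r))))
          ≡⟨ ∑-cong (finite-Π finite-local) split ⟩
        ∑⟨ finite-Π finite-local ⟩ (λ r → ∏ (λ k → crossed k (r k)) * Φ r) ∎
        where
        open ≡-Reasoning
        sel : (f g : ∀ k → V (A k) → Fin q) → ∀ k → V (A k) → Fin q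
        sel f g k x = if side (F.vertex k) then f k x else g k x
        select-cong : ∀ {f f′ g g′ : V H → Fin q} → f ≗ f′ → g ≗ g′ →
          select (side ∘ F.vertex ∘ part) f g ≗ select (side ∘ F.vertex ∘ part) f′ g′
        select-cong p q u = cong₂ (if side (F.vertex (part u)) then_else_) (p u) (q u)

        module _ (f g : ∀ k → V (A k) → Fin q) where
          local⇒ : ∀ k → Cross (A k) (sel f g k) (sel g f k) → Cross (A k) (f k) (g k)
          local⇒ k c with side (F.vertex k)
          ... | true  = c
          ... | false = Cross-sym (A k) c

          ⇒local : ∀ k → Cross (A k) (f k) (g k) → Cross (A k) (sel f g k) (sel g f k)
          ⇒local k c with side (F.vertex k)
          ... | true  = c
          ... | false = Cross-sym (A k) c

          across⇒ : Across (sel f g) (sel g f) → Across f f × Across g g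
          across⇒ a = (λ k l e → proj₁ (both k l e)) , (λ k l e → proj₂ (both k l e))
            where
            both : ∀ k l → F.vertex k F.~ F.vertex l → Disjoint (f k) (f l) × Disjoint (g k) (g l)
            both k l e with side (F.vertex k) | side (F.vertex l) | side-≢ _ _ e | a k l e | a l k (F.~-sym e)
            ... | true  | true  | s | _ | _ = contradiction refl s
            ... | true  | false | _ | d | d′ = d , (λ x y → d′ y x ∘ sym)
            ... | false | true  | _ | d | d′ = (λ x y → d′ y x ∘ sym) , d
            ... | false | false | s | _ | _ = contradiction refl s

          ⇒across : Across f f → Across g g → Across (sel f g) (sel g f)
          ⇒across a b k l e with side (F.vertex k) | side (F.vertex l) | side-≢ _ _ e
          ... | true  | true  | s = contradiction refl s
          ... | true  | false | _ = a k l e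
          ... | false | true  | _ = b k l e
          ... | false | false | s = contradiction refl s

        split : ∀ r → cross H (glue (sel (proj₁ ∘ r) (proj₂ ∘ r))) (glue (sel (proj₂ ∘ r) (proj₁ ∘ r))) ≡
          ∏ (λ k → crossed k (r k)) * Φ r
        split r = trans
          (⟦⟧-split (cross? H (glue (sel f g)) (glue (sel g f))) (all? c?) (compatible? r)
            (λ c → let (c₁ , c₂) = cross-unglue (sel f g) (sel g f) c in (λ k → local⇒ f g k (c₁ k)) , across⇒ f g c₂)
            (λ h (a , b) → glue-cross (sel f g) (sel g f) (λ k → ⇒local f g k (h k)) (⇒across f g a b)))
          (cong (_* Φ r) (sym (∏-⟦⟧ c?)))
          where
          f = proj₁ ∘ r
          g = proj₂ ∘ r
          c? = λ k → cross? (A k) (f k) (g k)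

      module _ (r : State) (i : Fin N) where

        -- Since `F` has no loops, the value of `f` at `i` itself is never consulted; the palette
        -- stays the same while part `i` is recoloured.
        avoiding : (∀ k → V (A k) → Fin q) → Palette q
        avoiding f c = ⌊ (all? λ l → (F.vertex i F.~? F.vertex l) →-dec ∀-dec (A.index l) λ y → ¬? (c ≟ f l y)) ⌋

        private
          X = avoiding (proj₁ ∘ r)
          Y = avoiding (proj₂ ∘ r)

        Elsewhere : Set
        Elsewhere = ∀ k l → k ≢ i → l ≢ i → F.vertex k F.~ F.vertex l →
          Disjoint (proj₁ (r k)) (proj₁ (r l)) × Disjoint (proj₂ (r k)) (proj₂ (r l))

        elsewhere? : Dec Elsewhere
        elsewhere? = all? λ k → all? λ l → ¬? (k ≟ i) →-dec (¬? (l ≟ i) →-dec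
          ((F.vertex k F.~? F.vertex l) →-dec
            (disjoint? (A.index k) (A.index l) (proj₁ (r k)) (proj₁ (r l)) ×-dec
             disjoint? (A.index k) (A.index l) (proj₂ (r k)) (proj₂ (r l)))))

        neighbour-≢ : ∀ {l} → F.vertex i F.~ F.vertex l → l ≢ i
        neighbour-≢ e refl = F.~-irrefl refl e

        -- `π` stands for `proj₁` or `proj₂`, so that both colourings of a state are treated by one
        -- argument.
        module _ (π : ∀ {k} → Setoid.Carrier (Local k) → V (A k) → Fin q) (s : Setoid.Carrier (Local i)) where
          private
            r′ = r [ i ≔ s ]

          within-of : Across (π ∘ r′) (π ∘ r′) → Within (avoiding (π ∘ r)) (π s)
          within-of a x = fromWitness λ l e y → subst₂ (λ s t → π s x ≢ π t y)
            (≔-same r i s) (≔-other r i s (neighbour-≢ e)) (a i l e x y)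

          elsewhere-of : Across (π ∘ r′) (π ∘ r′) →
            ∀ k l → k ≢ i → l ≢ i → F.vertex k F.~ F.vertex l → Disjoint (π (r k)) (π (r l))
          elsewhere-of a k l k≢i l≢i e = subst₂ (λ s t → Disjoint (π s) (π t))
            (≔-other r i s k≢i) (≔-other r i s l≢i) (a k l e)

          across-of : Within (avoiding (π ∘ r)) (π s) →
            (∀ k l → k ≢ i → l ≢ i → F.vertex k F.~ F.vertex l → Disjoint (π (r k)) (π (r l))) →
            Across (π ∘ r′) (π ∘ r′)
          across-of h a k l e with k ≟ i | l ≟ i
          ... | yes refl | yes refl = contradiction e (F.~-irrefl refl)
          ... | yes refl | no l≢i   = subst₂ (λ s t → Disjoint (π s) (π t))
            (sym (≔-same r i s)) (sym (≔-other r i s l≢i)) (λ x y → toWitness (h x) l e y)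
          ... | no k≢i   | yes refl = subst₂ (λ s t → Disjoint (π s) (π t))
            (sym (≔-other r i s k≢i)) (sym (≔-same r i s)) (λ x y → toWitness (h y) k (F.~-sym e) x ∘ sym)
          ... | no k≢i   | no l≢i   = subst₂ (λ s t → Disjoint (π s) (π t))
            (sym (≔-other r i s k≢i)) (sym (≔-other r i s l≢i)) (a k l k≢i l≢i e)

        -- Pairs of adjacent parts that avoid `i` contribute a factor independent of `f` and `g`;
        -- those that contain `i` only confine `f` to `X` and `g` to `Y`.
        Φ-slice : ∀ f g → Φ (r [ i ≔ (f , g) ]) ≡ ⟦ elsewhere? ⟧ * (fits (A i) X f * fits (A i) Y g)
        Φ-slice f g = trans
          (⟦⟧-split (compatible? (r [ i ≔ (f , g) ])) elsewhere? (X? ×-dec Y?)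
            (λ (a , b) →
              (λ k l k≢i l≢i e → elsewhere-of proj₁ (f , g) a k l k≢i l≢i e , elsewhere-of proj₂ (f , g) b k l k≢i l≢i e) ,
              within-of proj₁ (f , g) a , within-of proj₂ (f , g) b)
            (λ c (h , h′) →
              across-of proj₁ (f , g) h (λ k l k≢i l≢i e → proj₁ (c k l k≢i l≢i e)) ,
              across-of proj₂ (f , g) h′ (λ k l k≢i l≢i e → proj₂ (c k l k≢i l≢i e))))
          (cong (⟦ elsewhere? ⟧ *_) (⟦⟧-× X? Y?))
          where
          X? = within? (A.index i) X f
          Y? = within? (A.index i) Y g

        private
          ∑ᵢ = ∑ᴳ {q} (A i)

        slice : ∀ (w : Setoid.Carrier (Local i) → ℕ) →
          ∑⟨ finite-local i ⟩ (λ s → w s * Φ (r [ i ≔ s ])) ≡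
          ⟦ elsewhere? ⟧ * ∑ᵢ (λ f → ∑ᵢ (λ g → (fits (A i) X f * fits (A i) Y g) * w (f , g)))
        slice w = begin
          ∑⟨ finite-local i ⟩ (λ s → w s * Φ (r [ i ≔ s ]))
            ≡⟨ ∑-cong (finite-local i) (λ (f , g) →
                 trans (cong (w (f , g) *_) (Φ-slice f g)) (regroup (w (f , g)) ⟦ elsewhere? ⟧ _)) ⟩
          ∑⟨ finite-local i ⟩ (λ (f , g) → ⟦ elsewhere? ⟧ * ((fits (A i) X f * fits (A i) Y g) * w (f , g)))
            ≡⟨ ∑-*ˡ (finite-local i) ⟦ elsewhere? ⟧ _ ⟨
          ⟦ elsewhere? ⟧ * ∑⟨ finite-local i ⟩ (λ (f , g) → (fits (A i) X f * fits (A i) Y g) * w (f , g))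
            ≡⟨ cong (⟦ elsewhere? ⟧ *_) (∑-× (finite-colouring (A.index i)) (finite-colouring (A.index i))
                 (λ (f , g) → (fits (A i) X f * fits (A i) Y g) * w (f , g))) ⟩
          ⟦ elsewhere? ⟧ * ∑ᵢ (λ f → ∑ᵢ (λ g → (fits (A i) X f * fits (A i) Y g) * w (f , g))) ∎
          where
          open ≡-Reasoning
          regroup : ∀ a b c → a * (b * c) ≡ b * (c * a)
          regroup = solve-∀

        χ-product : χ (A i) X * χ (A i) Y ≡
          ∑ᵢ (λ f → ∑ᵢ (λ g → (fits (A i) X f * fits (A i) Y g) * straight i (f , g)))
        χ-product = trans
          (∑-product (finite-colouring (A.index i)) (finite-colouring (A.index i)) _ _)
          (∑-cong (finite-colouring (A.index i)) λ f → ∑-cong (finite-colouring (A.index i)) λ g → trans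
            (regroup (fits (A i) X f) (proper (A i) f) (fits (A i) Y g) (proper (A i) g))
            (cong ((fits (A i) X f * fits (A i) Y g) *_) (sym (⟦⟧-× (cross? (A i) f f) (cross? (A i) g g)))))
          where
          regroup : ∀ a b c d → (a * b) * (c * d) ≡ (a * c) * (b * d)
          regroup = solve-∀

        -- Once the constant factor `⟦ elsewhere? ⟧` is pulled out, the two sides are the product of
        -- the `χ` and the `χ₂` of the part for the palettes `X` and `Y`, which is what `Good`
        -- compares.
        slice-≤ : Good q (A i) →
          ∑⟨ finite-local i ⟩ (λ s → straight i s * Φ (r [ i ≔ s ])) ≤
          ∑⟨ finite-local i ⟩ (λ s → crossed i s * Φ (r [ i ≔ s ]))
        slice-≤ good = begin
          ∑⟨ finite-local i ⟩ (λ s → straight i s * Φ (r [ i ≔ s ]))   ≡⟨ slice (straight i) ⟩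
          ⟦ elsewhere? ⟧ * _                                           ≡⟨ cong (⟦ elsewhere? ⟧ *_) χ-product ⟨
          ⟦ elsewhere? ⟧ * (χ (A i) X * χ (A i) Y)                     ≤⟨ *-monoʳ-≤ ⟦ elsewhere? ⟧ (good X Y) ⟩
          ⟦ elsewhere? ⟧ * χ₂ (A i) X Y                                ≡⟨ slice (crossed i) ⟨
          ∑⟨ finite-local i ⟩ (λ s → crossed i s * Φ (r [ i ≔ s ]))    ∎
          where open ≤-Reasoning

      hom²≤hom-×K₂ : (∀ k → Good q (A k)) → hom H (K q) ^ 2 ≤ hom (H ×ᵍ K 2) (K q)
      hom²≤hom-×K₂ good = begin
        hom H (K q) ^ 2        ≡⟨ hom²-states ⟩
        _                      ≤⟨ replaceWeights finite-local straight crossed Φ (λ i r → slice-≤ r i (good i)) ⟩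
        _                      ≡⟨ hom-×K₂-states ⟨
        hom (H ×ᵍ K 2) (K q)   ∎
        where open ≤-Reasoning

blowUp-inequality : ∀ F H → Bipartite F → (q : ℕ) (𝓒 : Graph → Set) → (∀ G → 𝓒 G → Good q G) →
  IsBlowUp 𝓒 F H → hom H (K q) ^ 2 ≤ hom (H ×ᵍ K 2) (K q)
blowUp-inequality F H (side , side-≢) q 𝓒 𝓒⇒Good (Hs , 𝓒Hs , iso) =
  hom²≤hom-×K₂ H position
    (λ u v e → subst₂ (BlowUpAdj F Hs) (sym (locate u)) (sym (locate v)) (Equivalence.to (_≅_.preserves iso u v) e))
    (λ _ _ e → Equivalence.from (_≅_.preserves iso _ _)
      (subst₂ (BlowUpAdj F Hs) (sym (B.strictlyInverseˡ _)) (sym (B.strictlyInverseˡ _)) e))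
    side side-≢ (λ k → 𝓒⇒Good _ (𝓒Hs (Graph.vertex F k)))
  where
  open BlowUpColouring q F Hs
  module B = Inverse (_≅_.bijection iso)
  -- The parts are indexed by `Fin (size F)` so that `replaceWeights` can run through them by
  -- recursion.
  position : V H ↔ Σ (Fin (size F)) (V ∘ Hs ∘ Graph.vertex F)
  position = ↔-sym Σ-vertex ↔-∘ _≅_.bijection iso
  locate : ∀ u → Inverse.to Σ-vertex (Inverse.to position u) ≡ B.to u
  locate u = Inverse.strictlyInverseˡ Σ-vertex (B.to u)

-- Isomorphic graphs and edgeless graphs.

⟦⟧≤1 : {P : Set} (p : Dec P) → ⟦ p ⟧ ≤ 1
⟦⟧≤1 (yes _) = ≤-refl
⟦⟧≤1 (no _)  = z≤n

module _ {q : ℕ} where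

  fits-ext : ∀ G (X : Palette q) → Extensional (fits G X)
  fits-ext G X {f} {g} p = ⟦⟧-cong (within? (index G) X f) (within? (index G) X g)
    (Within-resp X p) (Within-resp X (sym ∘ p))

  χ-ext : ∀ G (X : Palette q) → Extensional (λ f → fits G X f * proper G f)
  χ-ext G X p = cong₂ _*_ (fits-ext G X p) (cross-ext G p p)

  χ₂-ext : ∀ G (X Y : Palette q) → Extensional₂ (λ f g → (fits G X f * fits G Y g) * cross G f g)
  χ₂-ext G X Y p q = cong₂ _*_ (cong₂ _*_ (fits-ext G X p) (fits-ext G Y q)) (cross-ext G p q)

  module _ {G G′ : Graph} (iso : G ≅ G′) where
    private
      b = _≅_.bijection iso
      module B = Inverse b

    fits-≅ : ∀ (X : Palette q) f → fits G X (f ∘ B.to) ≡ fits G′ X f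
    fits-≅ X f = ⟦⟧-cong (within? (index G) X (f ∘ B.to)) (within? (index G′) X f)
      (λ h v → subst (T ∘ X ∘ f) (B.strictlyInverseˡ v) (h (B.from v)))
      (λ h v → h (B.to v))

    cross-≅ : ∀ (f g : V G′ → Fin q) → cross G (f ∘ B.to) (g ∘ B.to) ≡ cross G′ f g
    cross-≅ f g = ⟦⟧-cong (cross? G (f ∘ B.to) (g ∘ B.to)) (cross? G′ f g)
      (λ c u v e → subst₂ (λ u v → f u ≢ g v) (B.strictlyInverseˡ u) (B.strictlyInverseˡ v)
        (c (B.from u) (B.from v) (Equivalence.from (_≅_.preserves iso _ _)
          (subst₂ (Graph._~_ G′) (sym (B.strictlyInverseˡ u)) (sym (B.strictlyInverseˡ v)) e))))
      (λ c u v e → c (B.to u) (B.to v) (Equivalence.to (_≅_.preserves iso u v) e))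

    χ-≅ : ∀ X → χ G X ≡ χ G′ X
    χ-≅ X = trans (∑-reindex (index G) (index G′) b (χ-ext G X))
      (∑-cong (finite-colouring (index G′)) λ f → cong₂ _*_ (fits-≅ X f) (cross-≅ f f))

    χ₂-≅ : ∀ X Y → χ₂ G X Y ≡ χ₂ G′ X Y
    χ₂-≅ X Y = trans
      (∑-reindex (index G) (index G′) b λ p → ∑-cong (finite-colouring (index G)) λ g → χ₂-ext G X Y p λ _ → refl)
      (∑-cong (finite-colouring (index G′)) λ f → trans
        (∑-reindex (index G) (index G′) b (χ₂-ext G X Y {f ∘ B.to} λ _ → refl))
        (∑-cong (finite-colouring (index G′)) λ g →
          cong₂ _*_ (cong₂ _*_ (fits-≅ X f) (fits-≅ Y g)) (cross-≅ f g)))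

    Good-≅ : Good q G′ → Good q G
    Good-≅ good X Y = subst₂ _≤_ (sym (cong₂ _*_ (χ-≅ X) (χ-≅ Y))) (sym (χ₂-≅ X Y)) (good X Y)

  -- Without edges `χ₂` is the number of all pairs of maps into the two palettes. This starts the
  -- inductions for paths and for complete multipartite graphs.
  Good-edgeless : ∀ G → (∀ u v → ¬ Graph._~_ G u v) → Good q G
  Good-edgeless G edgeless X Y = begin
    χ G X * χ G Y
      ≤⟨ *-mono-≤ (drop X) (drop Y) ⟩
    ∑ᴳ G (fits G X) * ∑ᴳ G (fits G Y)
      ≡⟨ ∑-product F F (fits G X) (fits G Y) ⟩
    ∑ᴳ G (λ f → ∑ᴳ G (λ g → fits G X f * fits G Y g))
      ≡⟨ ∑-cong F (λ f → ∑-cong F λ g → trans (sym (*-identityʳ _)) (cong ((fits G X f * fits G Y g) *_)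
           (sym (⟦⟧-yes (cross? G f g) λ u v e → contradiction e (edgeless u v))))) ⟩
    χ₂ G X Y ∎
    where
    open ≤-Reasoning
    F = finite-colouring (index G)
    drop : ∀ X → χ G X ≤ ∑ᴳ G (fits G X)
    drop X = ∑-mono F λ f → ≤-trans (*-monoʳ-≤ (fits G X f) (⟦⟧≤1 (cross? G f f))) (≤-reflexive (*-identityʳ _))

  -- Palette sizes and sums that avoid a colour.

  ∣_∣ᵖ : Palette q → ℕ
  ∣ X ∣ᵖ = sum (𝟙 ∘ X)

  differ : Fin q → Fin q → ℕ
  differ c d = ⟦ ¬? (c ≟ d) ⟧

  same : Fin q → Fin q → ℕ
  same c d = ⟦ c ≟ d ⟧

  differ+same : ∀ c d → differ c d + same c d ≡ 1
  differ+same c d with c ≟ d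
  ... | yes _ = refl
  ... | no _  = refl

  differ-sym : ∀ c d → differ c d ≡ differ d c
  differ-sym c d = ⟦⟧-cong (¬? (c ≟ d)) (¬? (d ≟ c)) (_∘ sym) (_∘ sym)

sum-product : ∀ {m n} (f : Fin m → ℕ) (g : Fin n → ℕ) → sum f * sum g ≡ sum (λ i → sum (λ j → f i * g j))
sum-product f g = trans (*-distribʳ-sum (sum g) f) (sum-cong-≗ λ i → *-distribˡ-sum (f i) g)

sum-same : ∀ {q} (w : Fin q → ℕ) d → sum (λ c → w c * same c d) ≡ w d
sum-same {suc q} w zero = trans (cong₂ _+_ (*-identityʳ (w zero)) (zeros (w ∘ suc))) (+-identityʳ (w zero))
  where
  zeros : ∀ {n} (v : Fin n → ℕ) → sum (λ c → v c * 0) ≡ 0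
  zeros {zero}  v = refl
  zeros {suc n} v = cong₂ _+_ (*-zeroʳ (v zero)) (zeros (v ∘ suc))
sum-same {suc q} w (suc d) = cong₂ _+_ (*-zeroʳ (w zero))
  (trans (sum-cong-≗ λ c → cong (w (suc c) *_) (⟦⟧-cong (suc c ≟ suc d) (c ≟ d) (λ { refl → refl }) (cong suc))) (sum-same (w ∘ suc) d))

module _ {q : ℕ} where

  sum-differ : ∀ (w : Fin q → ℕ) d → sum (λ c → w c * differ c d) + w d ≡ sum w
  sum-differ w d = begin
    sum (λ c → w c * differ c d) + w d                          ≡⟨ cong (sum (λ c → w c * differ c d) +_) (sum-same w d) ⟨
    sum (λ c → w c * differ c d) + sum (λ c → w c * same c d)   ≡⟨ ∑-distrib-+ (λ c → w c * differ c d) (λ c → w c * same c d) ⟨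
    sum (λ c → w c * differ c d + w c * same c d)               ≡⟨ sum-cong-≗ (λ c → trans (sym (*-distribˡ-+ (w c) _ _))
                                                                     (trans (cong (w c *_) (differ+same c d)) (*-identityʳ (w c)))) ⟩
    sum w                                                       ∎
    where open ≡-Reasoning

  ∑-∷₂ : ∀ n {φ : (Fin (suc n) → Fin q) → (Fin (suc n) → Fin q) → ℕ} → Extensional₂ φ →
    ∑ⁿ (suc n) (λ f → ∑ⁿ (suc n) (φ f)) ≡
    ∑ⁿ n (λ f → ∑ⁿ n (λ g → sum (λ c → sum (λ d → φ (c ∷ f) (d ∷ g)))))
  ∑-∷₂ n {φ} φ-ext = begin
    ∑ⁿ (suc n) (λ f → ∑ⁿ (suc n) (φ f))
      ≡⟨ ∑-∷ n (λ p → ∑-cong (finite-colouring (↔-id (Fin (suc n)))) λ g → φ-ext p λ _ → refl) ⟩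
    sum (λ c → ∑ⁿ n (λ f → ∑ⁿ (suc n) (φ (c ∷ f))))
      ≡⟨ ∑-sum F (λ f c → ∑ⁿ (suc n) (φ (c ∷ f))) ⟨
    ∑ⁿ n (λ f → sum (λ c → ∑ⁿ (suc n) (φ (c ∷ f))))
      ≡⟨ ∑-cong F (λ f → sum-cong-≗ λ c → trans (∑-∷ n (φ-ext {c ∷ f} λ _ → refl)) (sym (∑-sum F (λ g d → φ (c ∷ f) (d ∷ g))))) ⟩
    ∑ⁿ n (λ f → sum (λ c → ∑ⁿ n (λ g → sum (λ d → φ (c ∷ f) (d ∷ g)))))
      ≡⟨ ∑-cong F (λ f → sym (∑-sum F (λ g c → sum (λ d → φ (c ∷ f) (d ∷ g))))) ⟩
    ∑ⁿ n (λ f → ∑ⁿ n (λ g → sum (λ c → sum (λ d → φ (c ∷ f) (d ∷ g))))) ∎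
    where
    open ≡-Reasoning
    F = finite-colouring {q} (↔-id (Fin n))

  fitsⁿ : ∀ {n} → Palette q → (Fin n → Fin q) → ℕ
  fitsⁿ {n} X f = ⟦ within? (↔-id (Fin n)) X f ⟧

  fits-∷ : ∀ {n} (X : Palette q) c (f : Fin n → Fin q) → fitsⁿ X (c ∷ f) ≡ 𝟙 (X c) * fitsⁿ X f
  fits-∷ {n} X c f =
    ⟦⟧-split (within? (↔-id (Fin (suc n))) X (c ∷ f)) (T? (X c)) (within? (↔-id (Fin n)) X f)
      (λ h → h zero , h ∘ suc) (λ { t h zero → t ; t h (suc i) → h i })

  -- Paths.

  module _ (n : ℕ) where
    private
      P  = path (suc n)
      P⁺ = path (suc (suc n))

    -- The new end vertex has the old `zero` as its only neighbour, and in the product with `K 2`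
    -- this edge becomes two: `c` meets the other colouring's `g zero`, and `d` meets `f zero`.
    path-cross : ∀ c d (f g : Fin (suc n) → Fin q) →
      cross P⁺ (c ∷ f) (d ∷ g) ≡ (differ c (g zero) * differ d (f zero)) * cross P f g
    path-cross c d f g = trans
      (⟦⟧-split (cross? P⁺ (c ∷ f) (d ∷ g)) (¬? (c ≟ g zero) ×-dec ¬? (d ≟ f zero)) (cross? P f g)
        (λ k → (k zero (suc zero) (inj₁ refl) , k (suc zero) zero (inj₂ refl) ∘ sym) ,
               λ i j e → k (suc i) (suc j) (shift e))
        unshift)
      (cong (_* cross P f g) (⟦⟧-× (¬? (c ≟ g zero)) (¬? (d ≟ f zero))))
      where
      shift : ∀ {i j : Fin (suc n)} → Next i j ⊎ Next j i → Next (suc i) (suc j) ⊎ Next (suc j) (suc i)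
      shift (inj₁ e) = inj₁ (cong suc e)
      shift (inj₂ e) = inj₂ (cong suc e)
      unshift : c ≢ g zero × d ≢ f zero → Cross P f g → Cross P⁺ (c ∷ f) (d ∷ g)
      unshift (p , r) k zero          zero          (inj₁ ())
      unshift (p , r) k zero          zero          (inj₂ ())
      unshift (p , r) k zero          (suc zero)    e         = p
      unshift (p , r) k (suc zero)    zero          e         = r ∘ sym
      unshift (p , r) k (suc i)       (suc j)       (inj₁ e)  = k i j (inj₁ (suc-injective e))
      unshift (p , r) k (suc i)       (suc j)       (inj₂ e)  = k i j (inj₂ (suc-injective e))
      unshift (p , r) k zero          (suc (suc j)) (inj₁ ())
      unshift (p , r) k zero          (suc (suc j)) (inj₂ ())
      unshift (p , r) k (suc (suc i)) zero          (inj₁ ())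
      unshift (p , r) k (suc (suc i)) zero          (inj₂ ())

-- Allows a coefficient to be evaluated under a condition whose indicator is already a factor, here
-- that the old end vertex has its colour in the palette.
⟦⟧-guard : {P : Set} (d : Dec P) {a b : ℕ} → (P → a ≡ b) → ∀ p → a * (⟦ d ⟧ * p) ≡ b * (⟦ d ⟧ * p)
⟦⟧-guard (yes h) eq p = cong (_* (1 * p)) (eq h)
⟦⟧-guard (no _)  {a} {b} eq p = trans (*-zeroʳ a) (sym (*-zeroʳ b))

𝟙≤1 : ∀ b → 𝟙 b ≤ 1
𝟙≤1 true  = ≤-refl
𝟙≤1 false = z≤n

𝟙-T : ∀ {b} → T b → 𝟙 b ≡ 1
𝟙-T {true} _ = refl

module _ {q : ℕ} where

  avoid-one-≥ : ∀ (X : Palette q) d → ∣ X ∣ᵖ ∸ 1 ≤ sum (λ c → 𝟙 (X c) * differ c d)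
  avoid-one-≥ X d = m≤n+o⇒m∸n≤o ∣ X ∣ᵖ 1 (begin
    ∣ X ∣ᵖ                                              ≡⟨ sum-differ (𝟙 ∘ X) d ⟨
    sum (λ c → 𝟙 (X c) * differ c d) + 𝟙 (X d)         ≤⟨ +-monoʳ-≤ _ (𝟙≤1 (X d)) ⟩
    sum (λ c → 𝟙 (X c) * differ c d) + 1               ≡⟨ +-comm _ 1 ⟩
    1 + sum (λ c → 𝟙 (X c) * differ c d)               ∎)
    where open ≤-Reasoning

  avoid-one-∈ : ∀ (X : Palette q) d → T (X d) → sum (λ c → 𝟙 (X c) * differ c d) ≡ ∣ X ∣ᵖ ∸ 1
  avoid-one-∈ X d d∈X = begin
    sum (λ c → 𝟙 (X c) * differ c d)                   ≡⟨ m+n∸n≡m (sum (λ c → 𝟙 (X c) * differ c d)) 1 ⟨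
    sum (λ c → 𝟙 (X c) * differ c d) + 1 ∸ 1           ≡⟨ cong (λ t → sum (λ c → 𝟙 (X c) * differ c d) + t ∸ 1) (𝟙-T d∈X) ⟨
    sum (λ c → 𝟙 (X c) * differ c d) + 𝟙 (X d) ∸ 1     ≡⟨ cong (_∸ 1) (sum-differ (𝟙 ∘ X) d) ⟩
    ∣ X ∣ᵖ ∸ 1                                          ∎
    where open ≡-Reasoning

  module _ (n : ℕ) where
    private
      P  = path (suc n)
      P⁺ = path (suc (suc n))
      F  = finite-colouring {q} (index P)

    -- The colour `f zero` of the neighbour belongs to `X`, so it always costs one choice for the
    -- new vertex.
    path-χ : ∀ X → χ P⁺ X ≤ (∣ X ∣ᵖ ∸ 1) * χ P X
    path-χ X = begin
      χ P⁺ X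
        ≡⟨ ∑-∷ (suc n) (χ-ext P⁺ X) ⟩
      sum (λ c → ∑ᴳ P (λ f → fits P⁺ X (c ∷ f) * proper P⁺ (c ∷ f)))
        ≡⟨ ∑-sum F (λ f c → fits P⁺ X (c ∷ f) * proper P⁺ (c ∷ f)) ⟨
      ∑ᴳ P (λ f → sum (λ c → fits P⁺ X (c ∷ f) * proper P⁺ (c ∷ f)))
        ≤⟨ ∑-mono F bound ⟩
      ∑ᴳ P (λ f → (∣ X ∣ᵖ ∸ 1) * (fits P X f * proper P f))
        ≡⟨ ∑-*ˡ F (∣ X ∣ᵖ ∸ 1) _ ⟨
      (∣ X ∣ᵖ ∸ 1) * χ P X ∎
      where
      open ≤-Reasoning
      rearrange : ∀ a b d p → (a * b) * (d * p) ≡ (a * d) * (b * p)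
      rearrange = solve-∀
      -- For a single colouring the two constraints of `path-cross` coincide.
      differ² : ∀ c d → differ {q} c d * differ c d ≤ differ c d
      differ² c d with c ≟ d
      ... | yes _ = ≤-refl
      ... | no _  = ≤-refl
      bound : ∀ f → sum (λ c → fits P⁺ X (c ∷ f) * proper P⁺ (c ∷ f)) ≤ (∣ X ∣ᵖ ∸ 1) * (fits P X f * proper P f)
      bound f = begin
        sum (λ c → fits P⁺ X (c ∷ f) * proper P⁺ (c ∷ f))
          ≡⟨ sum-cong-≗ (λ c → cong₂ _*_ (fits-∷ X c f) (path-cross n c c f f)) ⟩
        sum (λ c → (𝟙 (X c) * fits P X f) * ((differ c (f zero) * differ c (f zero)) * proper P f))
          ≤⟨ sum-mono-≤ (λ c → *-monoʳ-≤ (𝟙 (X c) * fits P X f) (*-monoˡ-≤ (proper P f) (differ² c (f zero)))) ⟩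
        sum (λ c → (𝟙 (X c) * fits P X f) * (differ c (f zero) * proper P f))
          ≡⟨ sum-cong-≗ (λ c → rearrange (𝟙 (X c)) (fits P X f) (differ c (f zero)) (proper P f)) ⟩
        sum (λ c → (𝟙 (X c) * differ c (f zero)) * (fits P X f * proper P f))
          ≡⟨ *-distribʳ-sum (fits P X f * proper P f) (λ c → 𝟙 (X c) * differ c (f zero)) ⟨
        sum (λ c → 𝟙 (X c) * differ c (f zero)) * (fits P X f * proper P f)
          ≡⟨ ⟦⟧-guard (within? (index P) X f) (λ h → avoid-one-∈ X (f zero) (h zero)) (proper P f) ⟩
        (∣ X ∣ᵖ ∸ 1) * (fits P X f * proper P f) ∎

    -- The new vertex of `f` has to avoid `g zero`, a colour of `Y` that may lie outside `X`; at
    -- most one choice is lost. The same holds for `g`, and the two choices are independent.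
    path-χ₂ : ∀ X Y → ((∣ X ∣ᵖ ∸ 1) * (∣ Y ∣ᵖ ∸ 1)) * χ₂ P X Y ≤ χ₂ P⁺ X Y
    path-χ₂ X Y = begin
      ((∣ X ∣ᵖ ∸ 1) * (∣ Y ∣ᵖ ∸ 1)) * χ₂ P X Y
        ≡⟨ trans (∑-*ˡ F ((∣ X ∣ᵖ ∸ 1) * (∣ Y ∣ᵖ ∸ 1)) _) (∑-cong F λ f → ∑-*ˡ F ((∣ X ∣ᵖ ∸ 1) * (∣ Y ∣ᵖ ∸ 1)) _) ⟩
      ∑ᴳ P (λ f → ∑ᴳ P (λ g → ((∣ X ∣ᵖ ∸ 1) * (∣ Y ∣ᵖ ∸ 1)) * ((fits P X f * fits P Y g) * cross P f g)))
        ≤⟨ ∑-mono F (λ f → ∑-mono F λ g → bound f g) ⟩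
      ∑ᴳ P (λ f → ∑ᴳ P (λ g → sum (λ c → sum (λ d →
        (fits P⁺ X (c ∷ f) * fits P⁺ Y (d ∷ g)) * cross P⁺ (c ∷ f) (d ∷ g)))))
        ≡⟨ ∑-∷₂ (suc n) (χ₂-ext P⁺ X Y) ⟨
      χ₂ P⁺ X Y ∎
      where
      open ≤-Reasoning
      rearrange : ∀ a b d e p q r → (a * d) * (b * e) * ((p * q) * r) ≡ ((a * p) * (b * q)) * ((d * e) * r)
      rearrange = solve-∀
      bound : ∀ f g → ((∣ X ∣ᵖ ∸ 1) * (∣ Y ∣ᵖ ∸ 1)) * ((fits P X f * fits P Y g) * cross P f g) ≤
        sum (λ c → sum (λ d → (fits P⁺ X (c ∷ f) * fits P⁺ Y (d ∷ g)) * cross P⁺ (c ∷ f) (d ∷ g)))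
      bound f g = begin
        ((∣ X ∣ᵖ ∸ 1) * (∣ Y ∣ᵖ ∸ 1)) * w
          ≤⟨ *-monoˡ-≤ w (*-mono-≤ (avoid-one-≥ X (g zero)) (avoid-one-≥ Y (f zero))) ⟩
        (sum x * sum y) * w
          ≡⟨ cong (_* w) (sum-product x y) ⟩
        sum (λ c → sum (λ d → x c * y d)) * w
          ≡⟨ trans (*-distribʳ-sum w (λ c → sum (λ d → x c * y d))) (sum-cong-≗ λ c → *-distribʳ-sum w (λ d → x c * y d)) ⟩
        sum {q} (λ c → sum {q} (λ d → (x c * y d) * w))
          ≡⟨ sum-cong-≗ (λ c → sum-cong-≗ λ d → trans
               (rearrange (𝟙 (X c)) (𝟙 (Y d)) (differ c (g zero)) (differ d (f zero)) (fits P X f) (fits P Y g) (cross P f g))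
               (sym (cong₂ _*_ (cong₂ _*_ (fits-∷ X c f) (fits-∷ Y d g)) (path-cross n c d f g)))) ⟩
        sum (λ c → sum (λ d → (fits P⁺ X (c ∷ f) * fits P⁺ Y (d ∷ g)) * cross P⁺ (c ∷ f) (d ∷ g))) ∎
        where
        w = (fits P X f * fits P Y g) * cross P f g
        x y : Fin q → ℕ
        x c = 𝟙 (X c) * differ c (g zero)
        y d = 𝟙 (Y d) * differ d (f zero)

  Good-path : ∀ n → Good q (path n)
  Good-path zero          = Good-edgeless (path 0) λ ()
  Good-path (suc zero)    = Good-edgeless (path 1) λ { zero zero (inj₁ ()) ; zero zero (inj₂ ()) }
  Good-path (suc (suc n)) X Y = begin
    χ P⁺ X * χ P⁺ Y                                         ≤⟨ *-mono-≤ (path-χ n X) (path-χ n Y) ⟩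
    ((∣ X ∣ᵖ ∸ 1) * χ P X) * ((∣ Y ∣ᵖ ∸ 1) * χ P Y)           ≡⟨ rearrange (∣ X ∣ᵖ ∸ 1) (χ P X) (∣ Y ∣ᵖ ∸ 1) (χ P Y) ⟩
    ((∣ X ∣ᵖ ∸ 1) * (∣ Y ∣ᵖ ∸ 1)) * (χ P X * χ P Y)           ≤⟨ *-monoʳ-≤ ((∣ X ∣ᵖ ∸ 1) * (∣ Y ∣ᵖ ∸ 1)) (Good-path (suc n) X Y) ⟩
    ((∣ X ∣ᵖ ∸ 1) * (∣ Y ∣ᵖ ∸ 1)) * χ₂ P X Y                  ≤⟨ path-χ₂ n X Y ⟩
    χ₂ P⁺ X Y                                               ∎
    where
    open ≤-Reasoning
    P  = path (suc n)
    P⁺ = path (suc (suc n))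
    rearrange : ∀ a b c d → (a * b) * (c * d) ≡ (a * c) * (b * d)
    rearrange = solve-∀

-- Complete multipartite graphs

-- occupancy ψ m y z w is the sum of ψ(number of colours of W left unused) over the maps from an
-- m-element set to a palette Y, where |Y| = y, |Y ∩ W| = z and |W| = w.
occupancy : (ℕ → ℕ) → ℕ → ℕ → ℕ → ℕ → ℕ
occupancy ψ zero    y z w = ψ w
occupancy ψ (suc m) y z w = z * occupancy ψ m y (z ∸ 1) (w ∸ 1) + (y ∸ z) * occupancy ψ m y z w

module _ {ψ : ℕ → ℕ} (ψ-mono : ∀ {a b} → a ≤ b → ψ a ≤ ψ b) where
  private
    Ω = occupancy ψ

  occupancy-mono : ∀ m {y y′} z w → y ≤ y′ → Ω m y z w ≤ Ω m y′ z w
  occupancy-mono zero    z w y≤y′ = ≤-refl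
  occupancy-mono (suc m) z w y≤y′ = +-mono-≤
    (*-monoʳ-≤ z (occupancy-mono m (z ∸ 1) (w ∸ 1) y≤y′))
    (*-mono-≤ (∸-monoˡ-≤ z y≤y′) (occupancy-mono m z w y≤y′))

  occupancy-suc : ∀ m {x w} → w < x → Ω m x w w ≤ Ω m x (suc w) (suc w)
  occupancy-suc zero    {x} {w} w<x = ψ-mono (n≤1+n w)
  occupancy-suc (suc m) {x} {w} w<x = begin
    w * Ω m x (w ∸ 1) (w ∸ 1) + (x ∸ w) * Ω m x w w
      ≤⟨ +-mono-≤ (pred-≤ w w<x) (≤-reflexive (cong (_* Ω m x w w) x∸w)) ⟩
    w * Ω m x w w + (Ω m x w w + (x ∸ suc w) * Ω m x w w)
      ≡⟨ regroup (w * Ω m x w w) (Ω m x w w) ((x ∸ suc w) * Ω m x w w) ⟩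
    suc w * Ω m x w w + (x ∸ suc w) * Ω m x w w
      ≤⟨ +-monoʳ-≤ (suc w * Ω m x w w) (*-monoʳ-≤ (x ∸ suc w) (occupancy-suc m w<x)) ⟩
    suc w * Ω m x w w + (x ∸ suc w) * Ω m x (suc w) (suc w) ∎
    where
    open ≤-Reasoning
    x∸w : x ∸ w ≡ suc (x ∸ suc w)
    x∸w = +-∸-assoc 1 w<x
    regroup : ∀ a b c → a + (b + c) ≡ b + a + c
    regroup = solve-∀
    pred-≤ : ∀ w → w < x → w * Ω m x (w ∸ 1) (w ∸ 1) ≤ w * Ω m x w w
    pred-≤ zero    _   = z≤n
    pred-≤ (suc v) v<x = *-monoʳ-≤ (suc v) (occupancy-suc m (<-trans (n<1+n v) v<x))

  occupancy-pred : ∀ m {x w} → w ≤ x → Ω m x (w ∸ 1) (w ∸ 1) ≤ Ω m x w w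
  occupancy-pred m {w = zero}  _   = ≤-refl
  occupancy-pred m {w = suc w} w<x = occupancy-suc m w<x

  -- Provides the monotonicity of the next `ψ` when a further part is added.
  occupancy-diagonal-mono : ∀ m {a b} → a ≤ b → Ω m a a a ≤ Ω m b b b
  occupancy-diagonal-mono m a≤b = go (≤⇒≤′ a≤b)
    where
    go : ∀ {a b} → a ≤′ b → Ω m a a a ≤ Ω m b b b
    go ≤′-refl = ≤-refl
    go {b = suc b} (≤′-step p) = ≤-trans (go p)
      (≤-trans (occupancy-mono m b b (n≤1+n b)) (occupancy-suc m (n<1+n b)))

  -- The inequality `z * x ≤ w * y` says that a random colour of Y hits W with probability at most
  -- that of a random colour of the x-element palette. For `y ≤ x` it persists when `z` and `w` drop
  -- by one; for `y` larger than `x` it need not, and the stronger `z ≤ w` is carried instead.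
  Comparable : ℕ → ℕ → ℕ → ℕ → Set
  Comparable x y z w = (y ≤ x × z * x ≤ w * y) ⊎ (x ≤ y × z ≤ w)

  comparable-* : ∀ {x y z w} → Comparable x y z w → z * x ≤ w * y
  comparable-* (inj₁ (_ , p))     = p
  comparable-* (inj₂ (x≤y , z≤w)) = *-mono-≤ z≤w x≤y

  comparable-pred : ∀ {x y z w} → suc z ≤ y → Comparable x y (suc z) w → Comparable x y z (w ∸ 1)
  comparable-pred {zero} {zero} {w = zero} () (inj₁ _)
  comparable-pred {x} {y} {z} {suc w} _ (inj₁ (y≤x , p)) =
    inj₁ (y≤x , +-cancelˡ-≤ y _ _ (≤-trans (+-monoˡ-≤ (z * x) y≤x) p))
  comparable-pred {w = suc w} _ (inj₂ (x≤y , s≤s z≤w)) = inj₂ (x≤y , z≤w)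

  -- The number of colours of Y ∩ W hit by a random map to Y is stochastically at most the number of
  -- colours of W hit by a random map to an x-element palette containing W.
  occupancy-compare : ∀ m {x y z w} → w ≤ x → z ≤ y → Comparable x y z w →
    y ^ m * Ω m x w w ≤ x ^ m * Ω m y z w
  occupancy-compare zero    _ _ _ = ≤-refl
  occupancy-compare (suc m) {x} {y} {z} {w} w≤x z≤y cmp = begin
    y * y ^ m * (w * A + (x ∸ w) * B)
      ≡⟨ regroup₁ y (y ^ m) w A (x ∸ w) B ⟩
    y ^ m * (w * y * A + y * (x ∸ w) * B)
      ≤⟨ *-monoʳ-≤ (y ^ m) exchange-hits ⟩
    y ^ m * (z * x * A + x * (y ∸ z) * B)
      ≡⟨ regroup₂ x (y ^ m) z A (y ∸ z) B ⟩
    x * (z * (y ^ m * A) + (y ∸ z) * (y ^ m * B))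
      ≤⟨ *-monoʳ-≤ x (+-mono-≤ (hit z z≤y cmp) (*-monoʳ-≤ (y ∸ z) (occupancy-compare m w≤x z≤y cmp))) ⟩
    x * (z * (x ^ m * A′) + (y ∸ z) * (x ^ m * B′))
      ≡⟨ regroup₃ x (x ^ m) z A′ (y ∸ z) B′ ⟩
    x * x ^ m * (z * A′ + (y ∸ z) * B′) ∎
    where
    open ≤-Reasoning
    A  = Ω m x (w ∸ 1) (w ∸ 1)
    B  = Ω m x w w
    A′ = Ω m y (z ∸ 1) (w ∸ 1)
    B′ = Ω m y z w
    regroup₁ : ∀ y p w a v b → y * p * (w * a + v * b) ≡ p * (w * y * a + y * v * b)
    regroup₁ = solve-∀
    regroup₂ : ∀ x p z a u b → p * (z * x * a + x * u * b) ≡ x * (z * (p * a) + u * (p * b))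
    regroup₂ = solve-∀
    regroup₃ : ∀ x p z a u b → x * (z * (p * a) + u * (p * b)) ≡ x * p * (z * a + u * b)
    regroup₃ = solve-∀
    hit : ∀ z → z ≤ y → Comparable x y z w → z * (y ^ m * A) ≤ z * (x ^ m * Ω m y (z ∸ 1) (w ∸ 1))
    hit zero    _   _   = z≤n
    hit (suc z) z<y cmp = *-monoʳ-≤ (suc z)
      (occupancy-compare m (≤-trans (m∸n≤m w 1) w≤x) (<⇒≤ z<y) (comparable-pred z<y cmp))
    -- Scaled to the common total `x * y`, the hit case has weight `w * y` on one side and `z * x`
    -- on the other. The surplus `δ` is moved from `A` to `B`, which is at least as large by
    -- `occupancy-pred`.
    δ = w * y ∸ z * x
    total : x * (y ∸ z) ≡ y * (x ∸ w) + δ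
    total = +-cancelˡ-≡ (z * x) _ _ (trans (trans (side z x (y ∸ z)) (cong (_* x) (m+[n∸m]≡n z≤y)))
      (sym (trans (swap+ (z * x) (y * (x ∸ w)) δ) (trans (cong (_+ y * (x ∸ w)) (m∸n+n≡m (comparable-* cmp)))
        (trans (side w y (x ∸ w)) (trans (cong (_* y) (m+[n∸m]≡n w≤x)) (*-comm x y)))))))
      where
      side : ∀ z x u → z * x + x * u ≡ (z + u) * x
      side = solve-∀
      swap+ : ∀ a b c → a + (b + c) ≡ c + a + b
      swap+ = solve-∀
    exchange-hits : w * y * A + y * (x ∸ w) * B ≤ z * x * A + x * (y ∸ z) * B
    exchange-hits = begin
      w * y * A + y * (x ∸ w) * B
        ≡⟨ cong (λ t → t * A + y * (x ∸ w) * B) (m∸n+n≡m (comparable-* cmp)) ⟨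
      (δ + z * x) * A + y * (x ∸ w) * B
        ≡⟨ move₁ δ (z * x) A (y * (x ∸ w) * B) ⟩
      z * x * A + y * (x ∸ w) * B + δ * A
        ≤⟨ +-monoʳ-≤ (z * x * A + y * (x ∸ w) * B) (*-monoʳ-≤ δ (occupancy-pred m w≤x)) ⟩
      z * x * A + y * (x ∸ w) * B + δ * B
        ≡⟨ move₂ (z * x * A) (y * (x ∸ w)) δ B ⟩
      z * x * A + (y * (x ∸ w) + δ) * B
        ≡⟨ cong (λ t → z * x * A + t * B) total ⟨
      z * x * A + x * (y ∸ z) * B ∎
      where
      move₁ : ∀ d s a t → (d + s) * a + t ≡ s * a + t + d * a
      move₁ = solve-∀
      move₂ : ∀ s t d b → s + t * b + d * b ≡ s + (t + d) * b
      move₂ = solve-∀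

  -- Two uses of `occupancy-compare`, with the palettes in both orders, are multiplied; their
  -- factors are both `x ^ m * y ^ m` and cancel. If this product is zero, there is a vertex to
  -- colour from an empty palette, so the left side vanishes.
  occupancy-product : ∀ m x y z → z ≤ x → z ≤ y → Ω m x x x * Ω m y y y ≤ Ω m x z y * Ω m y z x
  occupancy-product m x y z z≤x z≤y with x ^ m * y ^ m in eq
  ... | zero = ≤-trans (≤-reflexive (vanish m eq)) z≤n
    where
    vanish : ∀ m → x ^ m * y ^ m ≡ 0 → Ω m x x x * Ω m y y y ≡ 0
    vanish zero    ()
    vanish (suc m) eq with m*n≡0⇒m≡0∨n≡0 (x ^ suc m) eq
    ... | inj₁ e with refl ← m^n≡0⇒m≡0 x (suc m) e = refl
    ... | inj₂ e with refl ← m^n≡0⇒m≡0 y (suc m) e = *-zeroʳ (Ω (suc m) x x x)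
  ... | suc k = *-cancelˡ-≤ (suc k) (begin
    suc k * (Ω m x x x * Ω m y y y)
      ≡⟨ cong (_* (Ω m x x x * Ω m y y y)) eq ⟨
    x ^ m * y ^ m * (Ω m x x x * Ω m y y y)
      ≡⟨ regroup₁ (x ^ m) (y ^ m) (Ω m x x x) (Ω m y y y) ⟩
    y ^ m * Ω m x x x * (x ^ m * Ω m y y y)
      ≤⟨ *-mono-≤ (occupancy-compare m ≤-refl z≤y (comparable z≤x z≤y)) (occupancy-compare m ≤-refl z≤x (comparable z≤y z≤x)) ⟩
    x ^ m * Ω m y z x * (y ^ m * Ω m x z y)
      ≡⟨ regroup₂ (x ^ m) (y ^ m) (Ω m y z x) (Ω m x z y) ⟩
    x ^ m * y ^ m * (Ω m x z y * Ω m y z x)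
      ≡⟨ cong (_* (Ω m x z y * Ω m y z x)) eq ⟩
    suc k * (Ω m x z y * Ω m y z x) ∎)
    where
    open ≤-Reasoning
    regroup₁ : ∀ p r a b → p * r * (a * b) ≡ r * a * (p * b)
    regroup₁ = solve-∀
    regroup₂ : ∀ p r a b → p * a * (r * b) ≡ p * r * (b * a)
    regroup₂ = solve-∀
    comparable : ∀ {x y} → z ≤ x → z ≤ y → Comparable x y z x
    comparable {x} {y} z≤x z≤y with ≤-total y x
    ... | inj₁ y≤x = inj₁ (y≤x , ≤-trans (≤-reflexive (*-comm z x)) (*-monoʳ-≤ x z≤y))
    ... | inj₂ x≤y = inj₂ (x≤y , z≤x)

-- Splits off the fibre over `zero`; the rest is partitioned into `r` classes, on which the
-- induction over the number of parts continues.
separate : ∀ n {r} (p : Fin n → Fin (suc r)) →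
  Σ[ a ∈ ℕ ] Σ[ b ∈ ℕ ] Σ[ e ∈ Fin n ↔ (Fin a ⊎ Fin b) ] Σ[ p′ ∈ (Fin b → Fin r) ]
    (∀ i → p (Inverse.from e (inj₁ i)) ≡ zero) × (∀ j → p (Inverse.from e (inj₂ j)) ≡ suc (p′ j))
separate zero p = 0 , 0 , mk↔ₛ′ (λ ()) [ (λ ()) , (λ ()) ] (λ { (inj₁ ()) ; (inj₂ ()) }) (λ ()) ,
  (λ ()) , (λ ()) , (λ ())
separate (suc n) p with separate n (p ∘ suc) | p zero in eq
... | a , b , e , p′ , p₁ , p₂ | zero =
  suc a , b , mk↔ₛ′ to from to∘from from∘to , p′ , (λ { zero → eq ; (suc i) → p₁ i }) , p₂
  where
  module E = Inverse e
  shift : Fin a ⊎ Fin b → Fin (suc a) ⊎ Fin b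
  shift = [ inj₁ ∘ suc , inj₂ ]
  to : Fin (suc n) → Fin (suc a) ⊎ Fin b
  to zero    = inj₁ zero
  to (suc i) = shift (E.to i)
  from : Fin (suc a) ⊎ Fin b → Fin (suc n)
  from (inj₁ zero)    = zero
  from (inj₁ (suc i)) = suc (E.from (inj₁ i))
  from (inj₂ j)       = suc (E.from (inj₂ j))
  to∘from : ∀ s → to (from s) ≡ s
  to∘from (inj₁ zero)    = refl
  to∘from (inj₁ (suc i)) = cong shift (E.strictlyInverseˡ (inj₁ i))
  to∘from (inj₂ j)       = cong shift (E.strictlyInverseˡ (inj₂ j))
  from-shift : ∀ s → from (shift s) ≡ suc (E.from s)
  from-shift (inj₁ _) = refl
  from-shift (inj₂ _) = refl
  from∘to : ∀ i → from (to i) ≡ i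
  from∘to zero    = refl
  from∘to (suc i) = trans (from-shift (E.to i)) (cong suc (E.strictlyInverseʳ i))
... | a , b , e , p′ , p₁ , p₂ | suc k =
  a , suc b , mk↔ₛ′ to from to∘from from∘to , (λ { zero → k ; (suc j) → p′ j }) , p₁ ,
    (λ { zero → eq ; (suc j) → p₂ j })
  where
  module E = Inverse e
  shift : Fin a ⊎ Fin b → Fin a ⊎ Fin (suc b)
  shift = [ inj₁ , inj₂ ∘ suc ]
  to : Fin (suc n) → Fin a ⊎ Fin (suc b)
  to zero    = inj₂ zero
  to (suc i) = shift (E.to i)
  from : Fin a ⊎ Fin (suc b) → Fin (suc n)
  from (inj₁ i)       = suc (E.from (inj₁ i))
  from (inj₂ zero)    = zero
  from (inj₂ (suc j)) = suc (E.from (inj₂ j))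
  to∘from : ∀ s → to (from s) ≡ s
  to∘from (inj₁ i)       = cong shift (E.strictlyInverseˡ (inj₁ i))
  to∘from (inj₂ zero)    = refl
  to∘from (inj₂ (suc j)) = cong shift (E.strictlyInverseˡ (inj₂ j))
  from-shift : ∀ s → from (shift s) ≡ suc (E.from s)
  from-shift (inj₁ _) = refl
  from-shift (inj₂ _) = refl
  from∘to : ∀ i → from (to i) ≡ i
  from∘to zero    = refl
  from∘to (suc i) = trans (from-shift (E.to i)) (cong suc (E.strictlyInverseʳ i))

multipartite : ∀ {n r} → (Fin n → Fin r) → Graph
multipartite {n} p = record
  { V        = Fin n
  ; size     = n
  ; index    = ↔-id (Fin n)
  ; _~_      = λ u v → p u ≢ p v
  ; ~-sym    = _∘ sym
  ; ~-irrefl = λ { refl p≢p → p≢p refl }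
  ; _~?_     = λ u v → ¬? (p u ≟ p v)
  }

isYes-⇔ : {P Q : Set} (p : Dec P) (q : Dec Q) → (P → Q) → (Q → P) → ⌊ p ⌋ ≡ ⌊ q ⌋
isYes-⇔ (yes _) (yes _) _ _ = refl
isYes-⇔ (no _)  (no _)  _ _ = refl
isYes-⇔ (yes p) (no ¬q) f _ = contradiction (f p) ¬q
isYes-⇔ (no ¬p) (yes q) _ g = contradiction (g q) ¬p

isYes-∧ : {P Q R : Set} (p : Dec P) (q : Dec Q) (r : Dec R) → (P → Q × R) → (Q → R → P) → ⌊ p ⌋ ≡ ⌊ q ⌋ ∧ ⌊ r ⌋
isYes-∧ p (yes x) (yes y) f g = isYes-⇔ p (yes x) (λ _ → x) (λ _ → g x y)
isYes-∧ p (yes x) (no ¬y) f g = isYes-⇔ p (no ¬y) (proj₂ ∘ f) (λ y → contradiction y ¬y)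
isYes-∧ p (no ¬x) r       f g = isYes-⇔ p (no ¬x) (proj₁ ∘ f) (λ x → contradiction x ¬x)

𝟙-∧ : ∀ a b → 𝟙 (a ∧ b) ≡ 𝟙 a * 𝟙 b
𝟙-∧ true  b = sym (*-identityˡ (𝟙 b))
𝟙-∧ false b = refl

𝟙-isYes : {P : Set} (p : Dec P) → 𝟙 ⌊ p ⌋ ≡ ⟦ p ⟧
𝟙-isYes (yes _) = refl
𝟙-isYes (no _)  = refl

⟦⟧-idem : {P : Set} (p : Dec P) → ⟦ p ⟧ * ⟦ p ⟧ ≡ ⟦ p ⟧
⟦⟧-idem (yes _) = refl
⟦⟧-idem (no _)  = refl

-- Palettes with colours removed.

module _ {q : ℕ} where

  ∣∣ᵖ-cong : {X Y : Palette q} → X ≗ Y → ∣ X ∣ᵖ ≡ ∣ Y ∣ᵖ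
  ∣∣ᵖ-cong X≗Y = sum-cong-≗ (cong 𝟙 ∘ X≗Y)

  infixl 6 _∩_ _∖_ _−_

  _∩_ : Palette q → Palette q → Palette q
  (X ∩ Y) c = X c ∧ Y c

  _∖_ : ∀ {n} → Palette q → (Fin n → Fin q) → Palette q
  (X ∖ s) c = X c ∧ ⌊ all? (λ i → ¬? (c ≟ s i)) ⌋

  _−_ : Palette q → Fin q → Palette q
  (X − d) c = X c ∧ ⌊ ¬? (c ≟ d) ⌋

  ∖-[] : ∀ X (s : Fin 0 → Fin q) → X ∖ s ≗ X
  ∖-[] X s c = ∧-identityʳ (X c)

  ∖-∷ : ∀ {n} X c (s : Fin n → Fin q) → X ∖ (c ∷ s) ≗ X − c ∖ s
  ∖-∷ X c s d = trans
    (cong (X d ∧_) (isYes-∧ (all? (λ i → ¬? (d ≟ (c ∷ s) i))) (¬? (d ≟ c)) (all? (λ i → ¬? (d ≟ s i)))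
      (λ h → h zero , h ∘ suc) (λ { p h zero → p ; p h (suc i) → h i })))
    (sym (∧-assoc (X d) _ _))

  -- Avoiding the colours of the removed part is absorbed into the palette, so the remaining graph
  -- is again counted by `χ` and `χ₂`.
  fits-∖ : ∀ {m n} X (f : Fin m → Fin q) (s : Fin n → Fin q) →
    fitsⁿ (X ∖ s) f ≡ fitsⁿ X f * ⟦ disjoint? (↔-id (Fin m)) (↔-id (Fin n)) f s ⟧
  fits-∖ {m} {n} X f s = ⟦⟧-split (within? (↔-id (Fin m)) (X ∖ s) f) (within? (↔-id (Fin m)) X f)
    (disjoint? (↔-id (Fin m)) (↔-id (Fin n)) f s)
    (λ h → proj₁ ∘ both h , λ x → toWitness (proj₂ (both h x)))
    (λ h d x → Equivalence.from (T-∧ {X (f x)}) (h x , fromWitness (d x)))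
    where
    both : Within (X ∖ s) f → ∀ x → T (X (f x)) × T ⌊ all? (λ i → ¬? (f x ≟ s i)) ⌋
    both h x = Equivalence.to (T-∧ {X (f x)}) (h x)

  ∣−∣ᵖ : ∀ X c → ∣ X − c ∣ᵖ ≡ ∣ X ∣ᵖ ∸ 𝟙 (X c)
  ∣−∣ᵖ X c = begin
    ∣ X − c ∣ᵖ                                  ≡⟨ m+n∸n≡m ∣ X − c ∣ᵖ (𝟙 (X c)) ⟨
    ∣ X − c ∣ᵖ + 𝟙 (X c) ∸ 𝟙 (X c)              ≡⟨ cong (_∸ 𝟙 (X c)) (trans (cong (_+ 𝟙 (X c)) eq) (sum-differ (𝟙 ∘ X) c)) ⟩
    ∣ X ∣ᵖ ∸ 𝟙 (X c)                            ∎
    where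
    open ≡-Reasoning
    eq : ∣ X − c ∣ᵖ ≡ sum (λ d → 𝟙 (X d) * differ d c)
    eq = sum-cong-≗ λ d → trans (𝟙-∧ (X d) ⌊ ¬? (d ≟ c) ⌋) (cong (𝟙 (X d) *_) (𝟙-isYes (¬? (d ≟ c))))

  module _ (ψ : ℕ → ℕ) where
    private
      Ω = occupancy ψ

    unused : ∀ m → Palette q → Palette q → ℕ
    unused m Y W = ∑ⁿ m (λ s → fitsⁿ Y s * ψ ∣ W ∖ s ∣ᵖ)

    unused-ext : ∀ m Y W → Extensional (λ (s : Fin m → Fin q) → fitsⁿ Y s * ψ ∣ W ∖ s ∣ᵖ)
    unused-ext m Y W {s} {t} p = cong₂ _*_
      (⟦⟧-cong (within? (↔-id (Fin m)) Y s) (within? (↔-id (Fin m)) Y t) (Within-resp Y p) (Within-resp Y (sym ∘ p)))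
      (cong ψ (∣∣ᵖ-cong λ c → cong (W c ∧_) (isYes-⇔ (all? (λ i → ¬? (c ≟ s i))) (all? (λ i → ¬? (c ≟ t i)))
        (λ h i → subst (c ≢_) (p i) (h i)) (λ h i → subst (c ≢_) (sym (p i)) (h i)))))

    -- Conditions on the first colour `c`. If `c` is in `Y ∩ W`, both this set and `W` lose one
    -- colour; if `c` is in `Y` only, neither changes. `Y` itself stays, since colours may repeat
    -- within an independent part.
    unused-occupancy : ∀ m Y W → unused m Y W ≡ Ω m ∣ Y ∣ᵖ ∣ Y ∩ W ∣ᵖ ∣ W ∣ᵖ
    unused-occupancy zero Y W = begin
      unused 0 Y W                     ≡⟨ ∑-[] _ (unused-ext 0 Y W) none ⟩
      fitsⁿ Y none * ψ ∣ W ∖ none ∣ᵖ    ≡⟨ cong₂ _*_ (⟦⟧-yes (within? (↔-id (Fin 0)) Y none) λ ()) (cong ψ (∣∣ᵖ-cong (∖-[] W none))) ⟩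
      1 * ψ ∣ W ∣ᵖ                      ≡⟨ *-identityˡ (ψ ∣ W ∣ᵖ) ⟩
      ψ ∣ W ∣ᵖ                          ∎
      where
      open ≡-Reasoning
      none : Fin 0 → Fin q
      none ()
    unused-occupancy (suc m) Y W = begin
      unused (suc m) Y W
        ≡⟨ ∑-∷ m (unused-ext (suc m) Y W) ⟩
      sum (λ c → ∑ⁿ m (λ s → fitsⁿ Y (c ∷ s) * ψ ∣ W ∖ (c ∷ s) ∣ᵖ))
        ≡⟨ sum-cong-≗ (λ c → trans
             (∑-cong F λ s → trans (cong₂ _*_ (fits-∷ Y c s) (cong ψ (∣∣ᵖ-cong (∖-∷ W c s)))) (*-assoc (𝟙 (Y c)) _ _))
             (sym (∑-*ˡ F (𝟙 (Y c)) _))) ⟩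
      sum (λ c → 𝟙 (Y c) * unused m Y (W − c))
        ≡⟨ sum-cong-≗ step ⟩
      sum (λ c → 𝟙 ((Y ∩ W) c) * A + 𝟙 ((Y ∩ (not ∘ W)) c) * B)
        ≡⟨ ∑-distrib-+ (λ c → 𝟙 ((Y ∩ W) c) * A) (λ c → 𝟙 ((Y ∩ (not ∘ W)) c) * B) ⟩
      sum (λ c → 𝟙 ((Y ∩ W) c) * A) + sum (λ c → 𝟙 ((Y ∩ (not ∘ W)) c) * B)
        ≡⟨ cong₂ _+_ (*-distribʳ-sum A (𝟙 ∘ (Y ∩ W))) (*-distribʳ-sum B (𝟙 ∘ (Y ∩ (not ∘ W)))) ⟨
      z * A + ∣ Y ∩ (not ∘ W) ∣ᵖ * B
        ≡⟨ cong (λ t → z * A + t * B) outside ⟩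
      z * A + (∣ Y ∣ᵖ ∸ z) * B ∎
      where
      open ≡-Reasoning
      F = finite-colouring {q} (↔-id (Fin m))
      z = ∣ Y ∩ W ∣ᵖ
      A = Ω m ∣ Y ∣ᵖ (z ∸ 1) (∣ W ∣ᵖ ∸ 1)
      B = Ω m ∣ Y ∣ᵖ z ∣ W ∣ᵖ
      ∩-− : ∀ c → Y ∩ (W − c) ≗ Y ∩ W − c
      ∩-− c d = sym (∧-assoc (Y d) (W d) _)
      reduce : ∀ c → unused m Y (W − c) ≡ Ω m ∣ Y ∣ᵖ (z ∸ 𝟙 ((Y ∩ W) c)) (∣ W ∣ᵖ ∸ 𝟙 (W c))
      reduce c = trans (unused-occupancy m Y (W − c))
        (cong₂ (Ω m ∣ Y ∣ᵖ) (trans (∣∣ᵖ-cong (∩-− c)) (∣−∣ᵖ (Y ∩ W) c)) (∣−∣ᵖ W c))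
      step : ∀ c → 𝟙 (Y c) * unused m Y (W − c) ≡ 𝟙 ((Y ∩ W) c) * A + 𝟙 ((Y ∩ (not ∘ W)) c) * B
      step c = trans (cong (𝟙 (Y c) *_) (reduce c)) (cases (Y c) (W c))
        where
        cases : ∀ y w → 𝟙 y * Ω m ∣ Y ∣ᵖ (z ∸ 𝟙 (y ∧ w)) (∣ W ∣ᵖ ∸ 𝟙 w) ≡ 𝟙 (y ∧ w) * A + 𝟙 (y ∧ not w) * B
        cases false w     = refl
        cases true  true  = sym (+-identityʳ (1 * A))
        cases true  false = refl
      outside : ∣ Y ∩ (not ∘ W) ∣ᵖ ≡ ∣ Y ∣ᵖ ∸ z
      outside = sym (trans (cong (_∸ z) (sym partition)) (m+n∸n≡m ∣ Y ∩ (not ∘ W) ∣ᵖ z))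
        where
        cases : ∀ y w → 𝟙 (y ∧ not w) + 𝟙 (y ∧ w) ≡ 𝟙 y
        cases false w     = refl
        cases true  true  = refl
        cases true  false = refl
        partition : ∣ Y ∩ (not ∘ W) ∣ᵖ + z ≡ ∣ Y ∣ᵖ
        partition = trans (sym (∑-distrib-+ (𝟙 ∘ (Y ∩ (not ∘ W))) (𝟙 ∘ (Y ∩ W)))) (sum-cong-≗ λ c → cases (Y c) (W c))

  disjointⁿ : ∀ {m n} → (Fin m → Fin q) → (Fin n → Fin q) → ℕ
  disjointⁿ {m} {n} f g = ⟦ disjoint? (↔-id (Fin m)) (↔-id (Fin n)) f g ⟧

  -- Adding one part to a complete multipartite graph.

  module _ {n r a b} {p : Fin n → Fin (suc r)} {p′ : Fin b → Fin r} (e : Fin n ↔ (Fin a ⊎ Fin b))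
    (p₁ : ∀ i → p (Inverse.from e (inj₁ i)) ≡ zero) (p₂ : ∀ j → p (Inverse.from e (inj₂ j)) ≡ suc (p′ j))
    where
    private
      module E = Inverse e
      G  = multipartite p
      G′ = multipartite p′
      F₁ = finite-colouring {q} (↔-id (Fin a))
      F₂ = finite-colouring {q} (↔-id (Fin b))

    join : (Fin a → Fin q) → (Fin b → Fin q) → Fin n → Fin q
    join s f = [ s , f ] ∘ E.to

    ∑-join : {φ : (Fin n → Fin q) → ℕ} → Extensional φ → ∑ᴳ G φ ≡ ∑ⁿ a (λ s → ∑ⁿ b (λ f → φ (join s f)))
    ∑-join {φ} φ-ext = trans (∑-reindex (↔-id (Fin n)) (↔-sym e) e φ-ext)
      (∑-⊎ (↔-id (Fin a)) (↔-id (Fin b)) (↔-sym e) {φ ∘ (_∘ E.to)} (λ h → φ-ext (h ∘ E.to)))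

    fits-join : ∀ X s f → fits G X (join s f) ≡ fitsⁿ X s * fitsⁿ X f
    fits-join X s f = ⟦⟧-split (within? (↔-id (Fin n)) X (join s f))
      (within? (↔-id (Fin a)) X s) (within? (↔-id (Fin b)) X f)
      (λ h → (λ i → subst (T ∘ X ∘ [ s , f ]) (E.strictlyInverseˡ (inj₁ i)) (h (E.from (inj₁ i)))) ,
             (λ j → subst (T ∘ X ∘ [ s , f ]) (E.strictlyInverseˡ (inj₂ j)) (h (E.from (inj₂ j)))))
      (λ h k v → both h k (E.to v))
      where
      both : Within X s → Within X f → ∀ v → T (X ([ s , f ] v))
      both h k (inj₁ i) = h i
      both h k (inj₂ j) = k j

    cross-join : ∀ s f t g → cross G (join s f) (join t g) ≡ (disjointⁿ g s * disjointⁿ f t) * cross G′ f g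
    cross-join s f t g = trans
      (⟦⟧-split (cross? G (join s f) (join t g)) (gs? ×-dec ft?) (cross? G′ f g)
        (λ c → ((λ j i → at c (inj₁ i) (inj₂ j) (λ eq → case trans (sym (p₁ i)) (trans eq (p₂ j)) of λ ()) ∘ sym) ,
                (λ j i → at c (inj₂ j) (inj₁ i) (λ eq → case trans (sym (p₁ i)) (trans (sym eq) (p₂ j)) of λ ()))) ,
               (λ i j i≢j → at c (inj₂ i) (inj₂ j) (λ eq → i≢j (Fin.suc-injective (trans (sym (p₂ i)) (trans eq (p₂ j)))))))
        (λ (d , d′) c u v u≢v → assemble d d′ c (E.to u) (E.to v)
          (subst₂ (λ u v → p u ≢ p v) (sym (E.strictlyInverseʳ u)) (sym (E.strictlyInverseʳ v)) u≢v)))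
      (cong (_* cross G′ f g) (⟦⟧-× gs? ft?))
      where
      gs? = disjoint? (↔-id (Fin b)) (↔-id (Fin a)) g s
      ft? = disjoint? (↔-id (Fin b)) (↔-id (Fin a)) f t
      at : Cross G (join s f) (join t g) → ∀ u v → p (E.from u) ≢ p (E.from v) → [ s , f ] u ≢ [ t , g ] v
      at c u v u≢v = subst₂ (λ u v → [ s , f ] u ≢ [ t , g ] v) (E.strictlyInverseˡ u) (E.strictlyInverseˡ v)
        (c (E.from u) (E.from v) u≢v)
      assemble : Disjoint g s → Disjoint f t → Cross G′ f g →
        ∀ u v → p (E.from u) ≢ p (E.from v) → [ s , f ] u ≢ [ t , g ] v
      assemble d d′ c (inj₁ i) (inj₁ j) u≢v = contradiction (trans (p₁ i) (sym (p₁ j))) u≢v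
      assemble d d′ c (inj₁ i) (inj₂ j) u≢v = d j i ∘ sym
      assemble d d′ c (inj₂ i) (inj₁ j) u≢v = d′ i j
      assemble d d′ c (inj₂ i) (inj₂ j) u≢v = c i j λ eq → u≢v (trans (p₂ i) (trans (cong suc eq) (sym (p₂ j))))

    χ-join : ∀ X → χ G X ≡ ∑ⁿ a (λ s → fitsⁿ X s * χ G′ (X ∖ s))
    χ-join X = trans (∑-join (χ-ext G X)) (∑-cong F₁ λ s → trans
      (∑-cong F₂ λ f → begin
        fits G X (join s f) * proper G (join s f)
          ≡⟨ cong₂ _*_ (fits-join X s f) (cross-join s f s f) ⟩
        (fitsⁿ X s * fitsⁿ X f) * ((disjointⁿ f s * disjointⁿ f s) * proper G′ f)
          ≡⟨ cong (λ d → (fitsⁿ X s * fitsⁿ X f) * (d * proper G′ f)) (⟦⟧-idem (disjoint? (↔-id (Fin b)) (↔-id (Fin a)) f s)) ⟩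
        (fitsⁿ X s * fitsⁿ X f) * (disjointⁿ f s * proper G′ f)
          ≡⟨ regroup (fitsⁿ X s) (fitsⁿ X f) (disjointⁿ f s) (proper G′ f) ⟩
        fitsⁿ X s * ((fitsⁿ X f * disjointⁿ f s) * proper G′ f)
          ≡⟨ cong (λ d → fitsⁿ X s * (d * proper G′ f)) (fits-∖ X f s) ⟨
        fitsⁿ X s * (fits G′ (X ∖ s) f * proper G′ f) ∎)
      (sym (∑-*ˡ F₂ (fitsⁿ X s) _)))
      where
      open ≡-Reasoning
      regroup : ∀ a b d c → (a * b) * (d * c) ≡ a * ((b * d) * c)
      regroup = solve-∀

    -- The part is joined to everything else and each edge compares the two colourings, so the
    -- restrictions cross over: `t`, taken from `Y`, shrinks the palette of `f`, and `s`, taken from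
    -- `X`, shrinks that of `g`.
    χ₂-join : ∀ X Y → χ₂ G X Y ≡ ∑ⁿ a (λ s → ∑ⁿ a (λ t → (fitsⁿ X s * fitsⁿ Y t) * χ₂ G′ (X ∖ t) (Y ∖ s)))
    χ₂-join X Y = begin
      χ₂ G X Y
        ≡⟨ ∑-join (λ h → ∑-cong (finite-colouring (↔-id (Fin n))) λ g → χ₂-ext G X Y h λ _ → refl) ⟩
      ∑ⁿ a (λ s → ∑ⁿ b (λ f → ∑ᴳ G (λ g → (fits G X (join s f) * fits G Y g) * cross G (join s f) g)))
        ≡⟨ ∑-cong F₁ (λ s → ∑-cong F₂ λ f → ∑-join (χ₂-ext G X Y {join s f} λ _ → refl)) ⟩
      ∑ⁿ a (λ s → ∑ⁿ b (λ f → ∑ⁿ a (λ t → ∑ⁿ b (λ g → w s f t g))))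
        ≡⟨ ∑-cong F₁ (λ s → ∑-swap F₂ F₁ (λ f t → ∑ⁿ b (λ g → w s f t g))) ⟩
      ∑ⁿ a (λ s → ∑ⁿ a (λ t → ∑ⁿ b (λ f → ∑ⁿ b (λ g → w s f t g))))
        ≡⟨ ∑-cong F₁ (λ s → ∑-cong F₁ λ t → trans
             (∑-cong F₂ λ f → trans (∑-cong F₂ λ g → pointwise s f t g) (sym (∑-*ˡ F₂ (fitsⁿ X s * fitsⁿ Y t) _)))
             (sym (∑-*ˡ F₂ (fitsⁿ X s * fitsⁿ Y t) _))) ⟩
      ∑ⁿ a (λ s → ∑ⁿ a (λ t → (fitsⁿ X s * fitsⁿ Y t) * χ₂ G′ (X ∖ t) (Y ∖ s))) ∎
      where
      open ≡-Reasoning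
      w : (Fin a → Fin q) → (Fin b → Fin q) → (Fin a → Fin q) → (Fin b → Fin q) → ℕ
      w s f t g = (fits G X (join s f) * fits G Y (join t g)) * cross G (join s f) (join t g)
      regroup : ∀ a b c d e h k → ((a * b) * (c * d)) * ((e * h) * k) ≡ (a * c) * (((b * h) * (d * e)) * k)
      regroup = solve-∀
      pointwise : ∀ s f t g → w s f t g ≡
        (fitsⁿ X s * fitsⁿ Y t) * ((fits G′ (X ∖ t) f * fits G′ (Y ∖ s) g) * cross G′ f g)
      pointwise s f t g = begin
        w s f t g
          ≡⟨ cong₂ _*_ (cong₂ _*_ (fits-join X s f) (fits-join Y t g)) (cross-join s f t g) ⟩
        ((fitsⁿ X s * fitsⁿ X f) * (fitsⁿ Y t * fitsⁿ Y g)) * ((disjointⁿ g s * disjointⁿ f t) * cross G′ f g)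
          ≡⟨ regroup (fitsⁿ X s) (fitsⁿ X f) (fitsⁿ Y t) (fitsⁿ Y g) (disjointⁿ g s) (disjointⁿ f t) (cross G′ f g) ⟩
        (fitsⁿ X s * fitsⁿ Y t) * (((fitsⁿ X f * disjointⁿ f t) * (fitsⁿ Y g * disjointⁿ g s)) * cross G′ f g)
          ≡⟨ cong₂ (λ u v → (fitsⁿ X s * fitsⁿ Y t) * ((u * v) * cross G′ f g)) (fits-∖ X f t) (fits-∖ Y g s) ⟨
        (fitsⁿ X s * fitsⁿ Y t) * ((fits G′ (X ∖ t) f * fits G′ (Y ∖ s) g) * cross G′ f g) ∎

    module _ {ψ : ℕ → ℕ} (ψ-mono : ∀ {i j} → i ≤ j → ψ i ≤ ψ j)
      (χ-ψ : ∀ (X : Palette q) → χ G′ X ≡ ψ ∣ X ∣ᵖ) (good : Good q G′) where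

      χ-unused : ∀ X → χ G X ≡ unused ψ a X X
      χ-unused X = trans (χ-join X) (∑-cong F₁ λ s → cong (fitsⁿ X s *_) (χ-ψ (X ∖ s)))

      χ-occupancy : ∀ X → χ G X ≡ occupancy ψ a ∣ X ∣ᵖ ∣ X ∣ᵖ ∣ X ∣ᵖ
      χ-occupancy X = trans (χ-unused X) (trans (unused-occupancy ψ a X X)
        (cong (λ z → occupancy ψ a ∣ X ∣ᵖ z ∣ X ∣ᵖ) (∣∣ᵖ-cong λ c → ∧-idem (X c))))

      Good-join : Good q G
      Good-join X Y = begin
        χ G X * χ G Y
          ≡⟨ cong₂ _*_ (χ-occupancy X) (χ-occupancy Y) ⟩
        occupancy ψ a x x x * occupancy ψ a y y y
          ≤⟨ occupancy-product ψ-mono a x y z (sum-mono-≤ λ c → 𝟙-∧-≤ˡ (X c) (Y c)) (sum-mono-≤ λ c → 𝟙-∧-≤ʳ (X c) (Y c)) ⟩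
        occupancy ψ a x z y * occupancy ψ a y z x
          ≡⟨ cong (λ t → occupancy ψ a x z y * occupancy ψ a y t x) (∣∣ᵖ-cong λ c → ∧-comm (X c) (Y c)) ⟩
        occupancy ψ a x z y * occupancy ψ a y ∣ Y ∩ X ∣ᵖ x
          ≡⟨ cong₂ _*_ (unused-occupancy ψ a X Y) (unused-occupancy ψ a Y X) ⟨
        unused ψ a X Y * unused ψ a Y X
          ≡⟨ ∑-product F₁ F₁ _ _ ⟩
        ∑ⁿ a (λ s → ∑ⁿ a (λ t → (fitsⁿ X s * ψ ∣ Y ∖ s ∣ᵖ) * (fitsⁿ Y t * ψ ∣ X ∖ t ∣ᵖ)))
          ≤⟨ ∑-mono F₁ (λ s → ∑-mono F₁ λ t → pointwise s t) ⟩
        ∑ⁿ a (λ s → ∑ⁿ a (λ t → (fitsⁿ X s * fitsⁿ Y t) * χ₂ G′ (X ∖ t) (Y ∖ s)))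
          ≡⟨ χ₂-join X Y ⟨
        χ₂ G X Y ∎
        where
        open ≤-Reasoning
        x = ∣ X ∣ᵖ
        y = ∣ Y ∣ᵖ
        z = ∣ X ∩ Y ∣ᵖ
        𝟙-∧-≤ˡ : ∀ a b → 𝟙 (a ∧ b) ≤ 𝟙 a
        𝟙-∧-≤ˡ true  true  = ≤-refl
        𝟙-∧-≤ˡ true  false = z≤n
        𝟙-∧-≤ˡ false _     = z≤n
        𝟙-∧-≤ʳ : ∀ a b → 𝟙 (a ∧ b) ≤ 𝟙 b
        𝟙-∧-≤ʳ true  _ = ≤-refl
        𝟙-∧-≤ʳ false _ = z≤n
        regroup : ∀ a b c d → (a * b) * (c * d) ≡ (a * c) * (d * b)
        regroup = solve-∀
        pointwise : ∀ s t → (fitsⁿ X s * ψ ∣ Y ∖ s ∣ᵖ) * (fitsⁿ Y t * ψ ∣ X ∖ t ∣ᵖ) ≤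
          (fitsⁿ X s * fitsⁿ Y t) * χ₂ G′ (X ∖ t) (Y ∖ s)
        pointwise s t = begin
          (fitsⁿ X s * ψ ∣ Y ∖ s ∣ᵖ) * (fitsⁿ Y t * ψ ∣ X ∖ t ∣ᵖ)
            ≡⟨ regroup (fitsⁿ X s) (ψ ∣ Y ∖ s ∣ᵖ) (fitsⁿ Y t) (ψ ∣ X ∖ t ∣ᵖ) ⟩
          (fitsⁿ X s * fitsⁿ Y t) * (ψ ∣ X ∖ t ∣ᵖ * ψ ∣ Y ∖ s ∣ᵖ)
            ≡⟨ cong₂ (λ u v → (fitsⁿ X s * fitsⁿ Y t) * (u * v)) (χ-ψ (X ∖ t)) (χ-ψ (Y ∖ s)) ⟨
          (fitsⁿ X s * fitsⁿ Y t) * (χ G′ (X ∖ t) * χ G′ (Y ∖ s))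
            ≤⟨ *-monoʳ-≤ (fitsⁿ X s * fitsⁿ Y t) (good (X ∖ t) (Y ∖ s)) ⟩
          (fitsⁿ X s * fitsⁿ Y t) * χ₂ G′ (X ∖ t) (Y ∖ s) ∎

  -- The induction needs more than `Good`: that the number of colourings depends only on the size of
  -- the palette, through a monotone `ψ`, which is the weight in the next occupancy count.
  multipartite-bound : ∀ r {n} (p : Fin n → Fin r) → Good q (multipartite p) ×
    Σ[ ψ ∈ (ℕ → ℕ) ] (∀ {i j} → i ≤ j → ψ i ≤ ψ j) × (∀ X → χ {q} (multipartite p) X ≡ ψ ∣ X ∣ᵖ)
  multipartite-bound zero {suc n} p = case p zero of λ ()
  multipartite-bound zero {zero}  p =
    Good-edgeless (multipartite p) (λ ()) , (λ _ → 1) , (λ _ → ≤-refl) ,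
    λ X → trans (∑-[] _ (χ-ext (multipartite p) X) none)
      (cong₂ _*_ (⟦⟧-yes (within? (↔-id (Fin 0)) X none) λ ()) (⟦⟧-yes (cross? (multipartite p) none none) λ ()))
    where
    none : Fin 0 → Fin q
    none ()
  multipartite-bound (suc r) {n} p with separate n p
  ... | a , b , e , p′ , p₁ , p₂ with multipartite-bound r p′
  ...   | good , ψ , ψ-mono , χ-ψ =
    Good-join e p₁ p₂ ψ-mono χ-ψ good , (λ x → occupancy ψ a x x x) ,
    occupancy-diagonal-mono ψ-mono a , χ-occupancy e p₁ p₂ ψ-mono χ-ψ good

  Good-completeMultipartite : ∀ G → CompleteMultipartite G → Good q G
  Good-completeMultipartite G (r , _ , part , _ , adjacent) =
    Good-≅ iso (proj₁ (multipartite-bound r (part ∘ Graph.vertex G)))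
    where
    iso : G ≅ multipartite (part ∘ Graph.vertex G)
    iso = record
      { bijection = index G
      ; preserves = λ u v → subst₂ (λ u′ v′ → Graph._~_ G u v ⇔ (part u′ ≢ part v′))
          (sym (Inverse.strictlyInverseʳ (index G) u)) (sym (Inverse.strictlyInverseʳ (index G) v)) (adjacent u v)
      }

-- Even cycles

^-distribʳ-* : ∀ k m n → (m * n) ^ k ≡ m ^ k * n ^ k
^-distribʳ-* zero    m n = refl
^-distribʳ-* (suc k) m n = trans (cong (m * n *_) (^-distribʳ-* k m n)) (regroup m n (m ^ k) (n ^ k))
  where
  regroup : ∀ m n p r → m * n * (p * r) ≡ m * p * (n * r)
  regroup = solve-∀

module _ (b d : ℕ) .{{_ : NonZero b}} where
  private
    a = b + d
    -- For palettes of sizes `b + 1` and `a + 1`, `c` equals 1 + (a - 1)(b + 1), the eigenvalue of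
    -- (a - 1)J + I of order `b + 1` on the all-ones vector.
    c = a * b + d
    W = a * (b * b)
    U = b * c

  -- Here U - W = b d = b (a - b), while `U` is at least `a` and `W` at least `b`. Hence the
  -- difference of the k-th powers of `U` and `W` is at least `b` times that of `a` and `b`. The
  -- differences are carried as witnesses in place of truncated subtraction.
  power-gap : ∀ k → Σ[ δ ∈ ℕ ] Σ[ ε ∈ ℕ ] U ^ k ≡ W ^ k + δ × a ^ k ≡ b ^ k + ε × b * ε ≤ δ
  power-gap zero    = 0 , 0 , refl , refl , ≤-reflexive (*-zeroʳ b)
  power-gap (suc k) with power-gap k
  ... | δ , ε , U^k , a^k , bε≤δ =
    -- Both witnesses telescope: the new difference is the larger base times the old difference,
    -- plus the difference of the bases times the old smaller power.
    U * δ + b * d * W ^ k , a * ε + d * b ^ k ,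
    trans (cong (U *_) U^k) (expandU b d (W ^ k) δ) ,
    trans (cong (a *_) a^k) (expandA b d (b ^ k) ε) ,
    (begin
      b * (a * ε + d * b ^ k)          ≡⟨ regroup b a ε d (b ^ k) ⟩
      a * (b * ε) + b * d * b ^ k      ≤⟨ +-mono-≤ (*-mono-≤ a≤U bε≤δ) (*-monoʳ-≤ (b * d) (^-monoˡ-≤ k b≤W)) ⟩
      U * δ + b * d * W ^ k            ∎)
    where
    open ≤-Reasoning
    instance
      a≢0 : NonZero a
      a≢0 = >-nonZero (≤-trans (>-nonZero⁻¹ b) (m≤m+n b d))
    expandU : ∀ b d w δ → b * ((b + d) * b + d) * (w + δ) ≡
      (b + d) * (b * b) * w + (b * ((b + d) * b + d) * δ + b * d * w)
    expandU = solve-∀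
    expandA : ∀ b d p ε → (b + d) * (p + ε) ≡ b * p + ((b + d) * ε + d * p)
    expandA = solve-∀
    regroup : ∀ b a ε d p → b * (a * ε + d * p) ≡ a * (b * ε) + b * d * p
    regroup = solve-∀
    a≤U : a ≤ U
    a≤U = ≤-trans (+-monoˡ-≤ d (m≤n*m b a)) (m≤n*m c b)
    b≤W : b ≤ W
    b≤W = ≤-trans (m≤m*n b b) (m≤n*m (b * b) a)

  -- Multiplied out, the two sides are `W ^ k + a ^ k * b` and `U ^ k + b ^ k * b`, so this is
  -- `power-gap` without differences.
  power-gap-≤ : ∀ k → a ^ k * (b ^ k * b ^ k + b) ≤ b ^ k * (c ^ k + b)
  power-gap-≤ k with power-gap k
  ... | δ , ε , U^k , a^k , bε≤δ = begin
    a ^ k * (b ^ k * b ^ k + b)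
      ≡⟨ *-distribˡ-+ (a ^ k) (b ^ k * b ^ k) b ⟩
    a ^ k * (b ^ k * b ^ k) + a ^ k * b
      ≡⟨ cong₂ _+_ (trans (cong (a ^ k *_) (sym (^-distribʳ-* k b b))) (sym (^-distribʳ-* k a (b * b)))) (cong (_* b) a^k) ⟩
    W ^ k + (b ^ k + ε) * b
      ≡⟨ regroup (W ^ k) (b ^ k) ε b ⟩
    W ^ k + b * ε + b ^ k * b
      ≤⟨ +-monoˡ-≤ (b ^ k * b) (+-monoʳ-≤ (W ^ k) bε≤δ) ⟩
    W ^ k + δ + b ^ k * b
      ≡⟨ cong (_+ b ^ k * b) (trans (sym U^k) (^-distribʳ-* k b c)) ⟩
    b ^ k * c ^ k + b ^ k * b
      ≡⟨ *-distribˡ-+ (b ^ k) (c ^ k) b ⟨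
    b ^ k * (c ^ k + b) ∎
    where
    open ≤-Reasoning
    regroup : ∀ w p ε b → w + (p + ε) * b ≡ w + b * ε + p * b
    regroup = solve-∀

  -- On the left are the chromatic polynomials of the cycle of length 2(k + 1) at b + 1 and at a + 1; on
  -- the right is the square of the number of its colourings that use two nested palettes of these sizes
  -- alternately.
  cycle-inequality : ∀ k → ((b * b) ^ suc k + b) * ((a * a) ^ suc k + a) ≤ (c ^ suc k + b) * (c ^ suc k + b)
  -- The factor `B * B` makes the right side a square that `power-gap-≤` bounds from below. What
  -- remains after the common factor `B * B + b` is only `leading`.
  cycle-inequality k = *-cancelˡ-≤ (B * B) {{m*n≢0 B B {{m^n≢0 b (suc k)}} {{m^n≢0 b (suc k)}}}} (begin
    B * B * (((b * b) ^ suc k + b) * ((a * a) ^ suc k + a))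
      ≡⟨ cong₂ (λ s t → B * B * ((s + b) * (t + a))) (^-distribʳ-* (suc k) b b) (^-distribʳ-* (suc k) a a) ⟩
    B * B * ((B * B + b) * (A * A + a))
      ≡⟨ regroup₁ (B * B) (B * B + b) (A * A) a ⟩
    (B * B + b) * (B * B * (A * A) + a * (B * B))
      ≤⟨ *-monoʳ-≤ (B * B + b) (+-monoʳ-≤ (B * B * (A * A)) leading) ⟩
    (B * B + b) * (B * B * (A * A) + b * (A * A))
      ≡⟨ regroup₂ (B * B) A b ⟩
    A * (B * B + b) * (A * (B * B + b))
      ≤⟨ *-mono-≤ (power-gap-≤ (suc k)) (power-gap-≤ (suc k)) ⟩
    B * (c ^ suc k + b) * (B * (c ^ suc k + b))
      ≡⟨ regroup₃ B (c ^ suc k + b) ⟩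
    B * B * ((c ^ suc k + b) * (c ^ suc k + b)) ∎)
    where
    open ≤-Reasoning
    A = a ^ suc k
    B = b ^ suc k
    regroup₁ : ∀ s t u a → s * (t * (u + a)) ≡ t * (s * u + a * s)
    regroup₁ = solve-∀
    regroup₂ : ∀ s t b → (s + b) * (s * (t * t) + b * (t * t)) ≡ t * (s + b) * (t * (s + b))
    regroup₂ = solve-∀
    regroup₃ : ∀ s t → s * t * (s * t) ≡ s * s * (t * t)
    regroup₃ = solve-∀
    pull : ∀ a b p → a * (b * p * (b * p)) ≡ a * b * (b * (p * p))
    pull = solve-∀
    pull′ : ∀ a b p → a * b * (a * (p * p)) ≡ b * (a * p * (a * p))
    pull′ = solve-∀
    b≤a : b ≤ a
    b≤a = m≤m+n b d
    -- The positive exponent supplies a factor `b` in `B` and a factor `a` in `A`, so that `a * b`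
    -- can be taken out on both sides.
    leading : a * (B * B) ≤ b * (A * A)
    leading = begin
      a * (B * B)                      ≡⟨ pull a b (b ^ k) ⟩
      a * b * (b * (b ^ k * b ^ k))    ≤⟨ *-monoʳ-≤ (a * b) (*-mono-≤ b≤a (*-mono-≤ (^-monoˡ-≤ k b≤a) (^-monoˡ-≤ k b≤a))) ⟩
      a * b * (a * (a ^ k * a ^ k))    ≡⟨ pull′ a b (a ^ k) ⟩
      b * (A * A)                      ∎

-- Alternating sequences.

alternate : ∀ {A : Set} {n} → A → A → Fin n → A
alternate x y zero    = x
alternate x y (suc i) = alternate y x i

alternate-map : ∀ {A B : Set} {n} (φ : A → B) x y (i : Fin n) → φ (alternate x y i) ≡ alternate (φ x) (φ y) i
alternate-map φ x y zero    = refl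
alternate-map φ x y (suc i) = alternate-map φ y x i

alternate-const : ∀ {A : Set} {n} (x : A) (i : Fin n) → alternate x x i ≡ x
alternate-const x zero    = refl
alternate-const x (suc i) = alternate-const x i

alternate-next : ∀ {A : Set} {n} {x y : A} (i j : Fin n) → Next i j → alternate x y j ≡ alternate y x i
alternate-next zero    (suc zero)    e  = refl
alternate-next zero    (suc (suc j)) ()
alternate-next (suc i) (suc j)       e  = alternate-next i j (suc-injective e)

-- The parity of the cycle enters here: an even number of positions ends on the second value, so the
-- closing edge also joins the two different values.
alternate-last : ∀ {A : Set} k {x y : A} (i : Fin (k * 2)) → suc (toℕ i) ≡ k * 2 → alternate x y i ≡ y
alternate-last (suc k) zero          ()
alternate-last (suc k) (suc zero)    e = refl
alternate-last (suc k) (suc (suc i)) e = alternate-last k i (suc-injective (suc-injective e))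

sum-vanish : ∀ {n} (f : Fin n → ℕ) → sum f ≡ 0 → ∀ i → f i ≡ 0
sum-vanish f eq zero    = m+n≡0⇒m≡0 (f zero) eq
sum-vanish f eq (suc i) = sum-vanish (f ∘ suc) (m+n≡0⇒n≡0 (f zero) eq) i

sum-zero : ∀ {n} {f : Fin n → ℕ} → (∀ i → f i ≡ 0) → sum f ≡ 0
sum-zero {zero}  h = refl
sum-zero {suc n} h = cong₂ _+_ (h zero) (sum-zero (h ∘ suc))

-- With J the all-ones and I the identity matrix of order x, (eJ + I)^(k + 1) = (power e x k) J + I.
power : ℕ → ℕ → ℕ → ℕ
power e x zero    = e
power e x (suc k) = e * power e x k * x + e + power e x k

-- Both sides are the eigenvalue of (eJ + I)^(k + 1) on the all-ones vector.
power-trace : ∀ e x k → x * power e x k + 1 ≡ (1 + e * x) ^ suc k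
power-trace e x zero    = regroup e x
  where
  regroup : ∀ e x → x * e + 1 ≡ (1 + e * x) * 1
  regroup = solve-∀
power-trace e x (suc k) = trans (regroup e x (power e x k)) (cong ((1 + e * x) *_) (power-trace e x k))
  where
  regroup : ∀ e x p → x * (e * p * x + e + p) + 1 ≡ (1 + e * x) * (x * p + 1)
  regroup = solve-∀

𝟙-guard-≤ : ∀ b {m n} → (T b → m ≤ n) → 𝟙 b * m ≤ 𝟙 b * n
𝟙-guard-≤ true  h = *-monoʳ-≤ 1 (h _)
𝟙-guard-≤ false h = z≤n

-- The trace of (eJ + I)^(k + 1) for matrices of order `x`.
trace : ℕ → ℕ → ℕ → ℕ
trace e x k = x * (power e x k + 1)

-- The trace as a sum of eigenvalues: that of the all-ones vector, and 1 with multiplicity `1 + p`.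
trace-power : ∀ e p k → trace e (2 + p) k ≡ (1 + e * (2 + p)) ^ suc k + (1 + p)
trace-power e p k = trans (split p (power e (2 + p) k)) (cong (_+ (1 + p)) (power-trace e (2 + p) k))
  where
  split : ∀ p α → (2 + p) * (α + 1) ≡ (2 + p) * α + 1 + (1 + p)
  split = solve-∀

-- This is `cycle-inequality` with `b` equal to `1 + p`, for palettes of sizes `2 + p` and
-- `2 + (p + d)`; the eigenvalues become `b * b`, `a * a` and `c`.
trace-inequality : ∀ p d k →
  trace p (2 + p) k * trace (p + d) (2 + (p + d)) k ≤ trace (p + d) (2 + p) k * trace (p + d) (2 + p) k
trace-inequality p d k = subst₂ _≤_
  (sym (cong₂ _*_ (trans (trace-power p p k) (cong (λ t → t ^ suc k + (1 + p)) (square p)))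
                  (trans (trace-power (p + d) (p + d) k) (cong (λ t → t ^ suc k + (1 + (p + d))) (square (p + d))))))
  (sym (cong₂ _*_ crossed crossed))
  (cycle-inequality (1 + p) d k)
  where
  square : ∀ p → 1 + p * (2 + p) ≡ (1 + p) * (1 + p)
  square = solve-∀
  mixed : ∀ p d → 1 + (p + d) * (2 + p) ≡ (1 + p + d) * (1 + p) + d
  mixed = solve-∀
  crossed : trace (p + d) (2 + p) k ≡ ((1 + p + d) * (1 + p) + d) ^ suc k + (1 + p)
  crossed = trans (trace-power (p + d) p k) (cong (λ t → t ^ suc k + (1 + p)) (mixed p d))

-- Transfer matrices and closed walks.

module _ {q : ℕ} where

  private
    Colour = Fin q

  same-sym : ∀ (c d : Colour) → same c d ≡ same d c
  same-sym c d = ⟦⟧-cong (c ≟ d) (d ≟ c) sym sym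

  step : Palette q → (Colour → ℕ) → Colour → ℕ
  step X φ u = sum (λ c → 𝟙 (X c) * (differ u c * φ c))

  -- Counts walks from `u` to `v` with `n` intermediate colours, drawn alternately from `X` and `Y`,
  -- and with consecutive colours distinct. The palettes do not restrict the endpoints.
  walk : ℕ → Palette q → Palette q → Colour → Colour → ℕ
  walk zero    X Y u v = differ u v
  walk (suc n) X Y u v = step X (λ c → walk n Y X c v) u

  -- closed n X Y counts the colourings of a cycle with n + 1 vertices that use X and Y alternately.
  closed : ℕ → Palette q → Palette q → ℕ
  closed n X Y = sum (λ u → 𝟙 (X u) * walk n Y X u u)

  step-cong : ∀ X {φ ψ : Colour → ℕ} → φ ≗ ψ → step X φ ≗ step X ψ
  step-cong X p u = sum-cong-≗ λ c → cong (λ t → 𝟙 (X c) * (differ u c * t)) (p c)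

  step-linear : ∀ X {n} (φ : Colour → Fin n → ℕ) (ρ : Fin n → ℕ) u →
    step X (λ c → sum (λ i → φ c i * ρ i)) u ≡ sum (λ i → step X (λ c → φ c i) u * ρ i)
  step-linear X φ ρ u = begin
    sum (λ c → 𝟙 (X c) * (differ u c * sum (λ i → φ c i * ρ i)))
      ≡⟨ sum-cong-≗ (λ c → trans (sym (*-assoc (𝟙 (X c)) (differ u c) _))
           (trans (*-distribˡ-sum (𝟙 (X c) * differ u c) (λ i → φ c i * ρ i))
             (sum-cong-≗ λ i → regroup (𝟙 (X c)) (differ u c) (φ c i) (ρ i)))) ⟩
    sum (λ c → sum (λ i → 𝟙 (X c) * (differ u c * φ c i) * ρ i))
      ≡⟨ ∑-comm (λ c i → 𝟙 (X c) * (differ u c * φ c i) * ρ i) ⟩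
    sum (λ i → sum (λ c → 𝟙 (X c) * (differ u c * φ c i) * ρ i))
      ≡⟨ sum-cong-≗ (λ i → sym (*-distribʳ-sum (ρ i) (λ c → 𝟙 (X c) * (differ u c * φ c i)))) ⟩
    sum (λ i → step X (λ c → φ c i) u * ρ i) ∎
    where
    open ≡-Reasoning
    regroup : ∀ a b c d → a * b * (c * d) ≡ a * (b * c) * d
    regroup = solve-∀

  -- With an odd number of intermediate colours the last one comes from the same palette as the
  -- first, so it can be split off at the far end.
  walk-snoc : ∀ k X Y u v →
    walk (suc (k * 2)) X Y u v ≡ sum (λ c → walk (k * 2) X Y u c * (𝟙 (X c) * differ c v))
  walk-snoc zero    X Y u v = sum-cong-≗ λ c → regroup (𝟙 (X c)) (differ u c) (differ c v)
    where
    regroup : ∀ a b c → a * (b * c) ≡ b * (a * c)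
    regroup = solve-∀
  walk-snoc (suc k) X Y u v = trans
    (step-cong X (λ c → trans (step-cong Y (λ d → walk-snoc k X Y d v) c)
      (step-linear Y (λ d e → walk (k * 2) X Y d e) (λ e → 𝟙 (X e) * differ e v) c)) u)
    (step-linear X (λ c e → walk (suc (k * 2)) Y X c e) (λ e → 𝟙 (X e) * differ e v) u)

  -- Starting the closed walk one vertex later exchanges the roles of the palettes; this is the
  -- cyclicity of the trace.
  closed-rotate : ∀ k X Y → closed (suc (k * 2)) X Y ≡ closed (suc (k * 2)) Y X
  closed-rotate k X Y = begin
    sum (λ u → 𝟙 (X u) * sum (λ c → 𝟙 (Y c) * (differ u c * walk (k * 2) X Y c u)))
      ≡⟨ sum-cong-≗ (λ u → *-distribˡ-sum (𝟙 (X u)) (λ c → 𝟙 (Y c) * (differ u c * walk (k * 2) X Y c u))) ⟩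
    sum (λ u → sum (λ c → 𝟙 (X u) * (𝟙 (Y c) * (differ u c * walk (k * 2) X Y c u))))
      ≡⟨ ∑-comm (λ u c → 𝟙 (X u) * (𝟙 (Y c) * (differ u c * walk (k * 2) X Y c u))) ⟩
    sum (λ c → sum (λ u → 𝟙 (X u) * (𝟙 (Y c) * (differ u c * walk (k * 2) X Y c u))))
      ≡⟨ sum-cong-≗ (λ c → trans
           (sum-cong-≗ λ u → regroup (𝟙 (X u)) (𝟙 (Y c)) (differ u c) (walk (k * 2) X Y c u))
           (sym (*-distribˡ-sum (𝟙 (Y c)) (λ u → walk (k * 2) X Y c u * (𝟙 (X u) * differ u c))))) ⟩
    sum (λ c → 𝟙 (Y c) * sum (λ u → walk (k * 2) X Y c u * (𝟙 (X u) * differ u c)))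
      ≡⟨ sum-cong-≗ (λ c → cong (𝟙 (Y c) *_) (walk-snoc k X Y c c)) ⟨
    closed (suc (k * 2)) Y X ∎
    where
    open ≡-Reasoning
    regroup : ∀ x y d w → x * (y * (d * w)) ≡ y * (w * (x * d))
    regroup = solve-∀

  twoStep : Palette q → Colour → Colour → ℕ
  twoStep Y u v = step Y (λ c → differ c v) u

  -- The middle colour ranges over `Y` without `u` and `v`; the factor `differ u v` prevents a
  -- common value from being removed twice.
  twoStep-count : ∀ Y u v → twoStep Y u v + (𝟙 (Y v) * differ u v + 𝟙 (Y u)) ≡ ∣ Y ∣ᵖ
  twoStep-count Y u v = begin
    twoStep Y u v + (𝟙 (Y v) * differ u v + 𝟙 (Y u))
      ≡⟨ cong (_+ (𝟙 (Y v) * differ u v + 𝟙 (Y u))) (sum-cong-≗ λ c → sym (*-assoc (𝟙 (Y c)) (differ u c) (differ c v))) ⟩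
    sum (λ c → 𝟙 (Y c) * differ u c * differ c v) + (𝟙 (Y v) * differ u v + 𝟙 (Y u))
      ≡⟨ +-assoc (sum (λ c → 𝟙 (Y c) * differ u c * differ c v)) (𝟙 (Y v) * differ u v) (𝟙 (Y u)) ⟨
    sum (λ c → 𝟙 (Y c) * differ u c * differ c v) + 𝟙 (Y v) * differ u v + 𝟙 (Y u)
      ≡⟨ cong (_+ 𝟙 (Y u)) (sum-differ (λ c → 𝟙 (Y c) * differ u c) v) ⟩
    sum (λ c → 𝟙 (Y c) * differ u c) + 𝟙 (Y u)
      ≡⟨ cong (_+ 𝟙 (Y u)) (sum-cong-≗ λ c → cong (𝟙 (Y c) *_) (differ-sym u c)) ⟩
    sum (λ c → 𝟙 (Y c) * differ c u) + 𝟙 (Y u)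
      ≡⟨ sum-differ (𝟙 ∘ Y) u ⟩
    ∣ Y ∣ᵖ ∎
    where open ≡-Reasoning

  -- At most two colours are excluded, and at most one if `u` and `v` agree. Entrywise, the two-step
  -- matrix dominates eJ + I.
  twoStep-lower : ∀ {e} Y u v → ∣ Y ∣ᵖ ≡ 2 + e → e + same u v ≤ twoStep Y u v
  twoStep-lower {e} Y u v Y≡ = +-cancelˡ-≤ 2 _ _ (begin
    2 + e + same u v
      ≡⟨ cong (_+ same u v) (trans (sym Y≡) (sym (twoStep-count Y u v))) ⟩
    twoStep Y u v + (𝟙 (Y v) * differ u v + 𝟙 (Y u)) + same u v
      ≤⟨ +-monoˡ-≤ (same u v) (+-monoʳ-≤ (twoStep Y u v) (+-mono-≤ (*-monoˡ-≤ (differ u v) (𝟙≤1 (Y v))) (𝟙≤1 (Y u)))) ⟩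
    twoStep Y u v + (1 * differ u v + 1) + same u v
      ≡⟨ regroup (twoStep Y u v) (differ u v) (same u v) ⟩
    (differ u v + same u v) + 1 + twoStep Y u v
      ≡⟨ cong (λ t → t + 1 + twoStep Y u v) (differ+same u v) ⟩
    2 + twoStep Y u v ∎)
    where
    open ≤-Reasoning
    regroup : ∀ t d s → t + (1 * d + 1) + s ≡ (d + s) + 1 + t
    regroup = solve-∀

  twoStep-∈ : ∀ {e} Y u v → ∣ Y ∣ᵖ ≡ 2 + e → T (Y u) → T (Y v) → twoStep Y u v ≡ e + same u v
  twoStep-∈ {e} Y u v Y≡ u∈Y v∈Y = +-cancelˡ-≡ 2 _ _ (begin
    2 + twoStep Y u v
      ≡⟨ cong (λ t → t + 1 + twoStep Y u v) (differ+same u v) ⟨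
    (differ u v + same u v) + 1 + twoStep Y u v
      ≡⟨ regroup (twoStep Y u v) (differ u v) (same u v) ⟨
    twoStep Y u v + (1 * differ u v + 1) + same u v
      ≡⟨ cong₂ (λ s t → twoStep Y u v + (s * differ u v + t) + same u v) (𝟙-T v∈Y) (𝟙-T u∈Y) ⟨
    twoStep Y u v + (𝟙 (Y v) * differ u v + 𝟙 (Y u)) + same u v
      ≡⟨ cong (_+ same u v) (trans (twoStep-count Y u v) Y≡) ⟩
    2 + e + same u v ∎)
    where
    open ≡-Reasoning
    regroup : ∀ t d s → t + (1 * d + 1) + s ≡ (d + s) + 1 + t
    regroup = solve-∀

  walk-twoStep : ∀ k X Y u v →
    walk (suc (suc k * 2)) Y X u v ≡ sum (λ d → 𝟙 (X d) * (twoStep Y u d * walk (suc (k * 2)) Y X d v))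
  walk-twoStep k X Y u v = begin
    step Y (λ c → step X (λ d → walk (suc (k * 2)) Y X d v) c) u
      ≡⟨ step-cong Y (λ c → sum-cong-≗ λ d → regroup (𝟙 (X d)) (differ c d) (walk (suc (k * 2)) Y X d v)) u ⟩
    step Y (λ c → sum (λ d → differ c d * (𝟙 (X d) * walk (suc (k * 2)) Y X d v))) u
      ≡⟨ step-linear Y (λ c d → differ c d) (λ d → 𝟙 (X d) * walk (suc (k * 2)) Y X d v) u ⟩
    sum (λ d → twoStep Y u d * (𝟙 (X d) * walk (suc (k * 2)) Y X d v))
      ≡⟨ sum-cong-≗ (λ d → regroup (twoStep Y u d) (𝟙 (X d)) (walk (suc (k * 2)) Y X d v)) ⟩
    sum (λ d → 𝟙 (X d) * (twoStep Y u d * walk (suc (k * 2)) Y X d v)) ∎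
    where
    open ≡-Reasoning
    regroup : ∀ a b c → a * (b * c) ≡ b * (a * c)
    regroup = solve-∀

  -- The matrix product (eJ + I)(αJ + I) over the index set `X`, where J² is `∣ X ∣ᵖ` times J.
  power-step : ∀ e α X u v → T (X u) → T (X v) →
    sum (λ d → 𝟙 (X d) * ((e + same u d) * (α + same d v))) ≡ e * α * ∣ X ∣ᵖ + e + α + same u v
  power-step e α X u v u∈X v∈X = begin
    sum (λ d → 𝟙 (X d) * ((e + same u d) * (α + same d v)))
      ≡⟨ sum-cong-≗ (λ d → trans (cong (λ s → 𝟙 (X d) * ((e + s) * (α + same d v))) (same-sym u d))
           (expand (𝟙 (X d)) e α (same d u) (same d v))) ⟩
    sum (λ d → 𝟙 (X d) * (e * α) + 𝟙 (X d) * e * same d v + 𝟙 (X d) * (α + same d v) * same d u)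
      ≡⟨ ∑-distrib-+ (λ d → 𝟙 (X d) * (e * α) + 𝟙 (X d) * e * same d v) (λ d → 𝟙 (X d) * (α + same d v) * same d u) ⟩
    sum (λ d → 𝟙 (X d) * (e * α) + 𝟙 (X d) * e * same d v) + sum (λ d → 𝟙 (X d) * (α + same d v) * same d u)
      ≡⟨ cong₂ _+_ (∑-distrib-+ (λ d → 𝟙 (X d) * (e * α)) (λ d → 𝟙 (X d) * e * same d v))
           (sum-same (λ d → 𝟙 (X d) * (α + same d v)) u) ⟩
    sum (λ d → 𝟙 (X d) * (e * α)) + sum (λ d → 𝟙 (X d) * e * same d v) + 𝟙 (X u) * (α + same u v)
      ≡⟨ cong₂ (λ s t → s + t + 𝟙 (X u) * (α + same u v)) (sym (*-distribʳ-sum (e * α) (𝟙 ∘ X)))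
           (sum-same (λ d → 𝟙 (X d) * e) v) ⟩
    ∣ X ∣ᵖ * (e * α) + 𝟙 (X v) * e + 𝟙 (X u) * (α + same u v)
      ≡⟨ cong₂ (λ s t → ∣ X ∣ᵖ * (e * α) + s * e + t * (α + same u v)) (𝟙-T v∈X) (𝟙-T u∈X) ⟩
    ∣ X ∣ᵖ * (e * α) + 1 * e + 1 * (α + same u v)
      ≡⟨ collect ∣ X ∣ᵖ e α (same u v) ⟩
    e * α * ∣ X ∣ᵖ + e + α + same u v ∎
    where
    open ≡-Reasoning
    expand : ∀ x e α s t → x * ((e + s) * (α + t)) ≡ x * (e * α) + x * e * t + x * (α + t) * s
    expand = solve-∀
    collect : ∀ x e α s → x * (e * α) + 1 * e + 1 * (α + s) ≡ e * α * x + e + α + s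
    collect = solve-∀

  -- Products preserve entrywise bounds between nonnegative matrices, so `twoStep-lower` passes to
  -- powers of the two-step matrix.
  walk-lower : ∀ k {e} X Y → ∣ Y ∣ᵖ ≡ 2 + e → ∀ u v → T (X u) → T (X v) →
    power e ∣ X ∣ᵖ k + same u v ≤ walk (suc (k * 2)) Y X u v
  walk-lower zero    X Y Y≡ u v _   _   = twoStep-lower Y u v Y≡
  walk-lower (suc k) {e} X Y Y≡ u v u∈X v∈X = begin
    e * α * ∣ X ∣ᵖ + e + α + same u v
      ≡⟨ power-step e α X u v u∈X v∈X ⟨
    sum (λ d → 𝟙 (X d) * ((e + same u d) * (α + same d v)))
      ≤⟨ sum-mono-≤ (λ d → 𝟙-guard-≤ (X d) λ d∈X →
           *-mono-≤ (twoStep-lower Y u d Y≡) (walk-lower k X Y Y≡ d v d∈X v∈X)) ⟩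
    sum (λ d → 𝟙 (X d) * (twoStep Y u d * walk (suc (k * 2)) Y X d v))
      ≡⟨ walk-twoStep k X Y u v ⟨
    walk (suc (suc k * 2)) Y X u v ∎
    where
    open ≤-Reasoning
    α = power e ∣ X ∣ᵖ k

  -- With a single palette the endpoints of each double step lie in it, so by `twoStep-∈` the
  -- two-step matrix is eJ + I itself.
  walk-upper : ∀ k {e} X → ∣ X ∣ᵖ ≡ 2 + e → ∀ u v → T (X u) → T (X v) →
    walk (suc (k * 2)) X X u v ≤ power e ∣ X ∣ᵖ k + same u v
  walk-upper zero    X X≡ u v u∈X v∈X = ≤-reflexive (twoStep-∈ X u v X≡ u∈X v∈X)
  walk-upper (suc k) {e} X X≡ u v u∈X v∈X = begin
    walk (suc (suc k * 2)) X X u v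
      ≡⟨ walk-twoStep k X X u v ⟩
    sum (λ d → 𝟙 (X d) * (twoStep X u d * walk (suc (k * 2)) X X d v))
      ≤⟨ sum-mono-≤ (λ d → 𝟙-guard-≤ (X d) λ d∈X →
           *-mono-≤ (≤-reflexive (twoStep-∈ X u d X≡ u∈X d∈X)) (walk-upper k X X≡ d v d∈X v∈X)) ⟩
    sum (λ d → 𝟙 (X d) * ((e + same u d) * (α + same d v)))
      ≡⟨ power-step e α X u v u∈X v∈X ⟩
    e * α * ∣ X ∣ᵖ + e + α + same u v ∎
    where
    open ≤-Reasoning
    α = power e ∣ X ∣ᵖ k

  same-refl : ∀ (c : Colour) → same c c ≡ 1
  same-refl c = ⟦⟧-yes (c ≟ c) refl

  closed-lower : ∀ k {e} X Y → ∣ Y ∣ᵖ ≡ 2 + e → trace e ∣ X ∣ᵖ k ≤ closed (suc (k * 2)) X Y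
  closed-lower k {e} X Y Y≡ = begin
    ∣ X ∣ᵖ * (power e ∣ X ∣ᵖ k + 1)                    ≡⟨ *-distribʳ-sum (power e ∣ X ∣ᵖ k + 1) (𝟙 ∘ X) ⟩
    sum (λ u → 𝟙 (X u) * (power e ∣ X ∣ᵖ k + 1))      ≤⟨ sum-mono-≤ (λ u → 𝟙-guard-≤ (X u) λ u∈X →
                                                          ≤-trans (≤-reflexive (cong (power e ∣ X ∣ᵖ k +_) (sym (same-refl u))))
                                                            (walk-lower k X Y Y≡ u u u∈X u∈X)) ⟩
    closed (suc (k * 2)) X Y                         ∎
    where open ≤-Reasoning

  closed-upper : ∀ k {e} X → ∣ X ∣ᵖ ≡ 2 + e → closed (suc (k * 2)) X X ≤ trace e ∣ X ∣ᵖ k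
  closed-upper k {e} X X≡ = begin
    closed (suc (k * 2)) X X                         ≤⟨ sum-mono-≤ (λ u → 𝟙-guard-≤ (X u) λ u∈X →
                                                          ≤-trans (walk-upper k X X≡ u u u∈X u∈X)
                                                            (≤-reflexive (cong (power e ∣ X ∣ᵖ k +_) (same-refl u)))) ⟩
    sum (λ u → 𝟙 (X u) * (power e ∣ X ∣ᵖ k + 1))      ≡⟨ *-distribʳ-sum (power e ∣ X ∣ᵖ k + 1) (𝟙 ∘ X) ⟨
    ∣ X ∣ᵖ * (power e ∣ X ∣ᵖ k + 1)                    ∎
    where open ≤-Reasoning

  -- One colour cannot serve both ends of an edge. This settles the sizes for which `∣ X ∣ᵖ ∸ 2`
  -- would be truncated.
  closed-small : ∀ n X → ∣ X ∣ᵖ ≤ 1 → closed (suc n) X X ≡ 0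
  closed-small n X X≤1 = sum-zero λ u → vanish u (T? (X u))
    where
    vanish : ∀ u → Dec (T (X u)) → 𝟙 (X u) * walk (suc n) X X u u ≡ 0
    vanish u (yes u∈X) = trans (cong (𝟙 (X u) *_) (sum-zero λ c → trans
        (sym (*-assoc (𝟙 (X c)) (differ u c) _)) (cong (_* walk n X X c u) (no-neighbour c))))
      (*-zeroʳ (𝟙 (X u)))
      where
      no-neighbour : ∀ c → 𝟙 (X c) * differ u c ≡ 0
      no-neighbour c = trans (cong (𝟙 (X c) *_) (differ-sym u c))
        (sum-vanish (λ c → 𝟙 (X c) * differ c u) (trans (avoid-one-∈ X u u∈X) (m≤n⇒m∸n≡0 X≤1)) c)
    vanish u (no u∉X) with X u
    ... | true  = contradiction _ u∉X
    ... | false = refl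

  closed-≤ : ∀ k X Y → ∣ X ∣ᵖ ≤ ∣ Y ∣ᵖ →
    closed (suc (k * 2)) X X * closed (suc (k * 2)) Y Y ≤ closed (suc (k * 2)) X Y * closed (suc (k * 2)) X Y
  closed-≤ k X Y X≤Y with ∣ X ∣ᵖ ≤? 1
  ... | yes X≤1 = ≤-trans (≤-reflexive (cong (_* closed (suc (k * 2)) Y Y) (closed-small (k * 2) X X≤1))) z≤n
  ... | no X≰1 = begin
    closed n X X * closed n Y Y
      ≤⟨ *-mono-≤ (closed-upper k X X≡) (closed-upper k Y Y≡) ⟩
    trace p ∣ X ∣ᵖ k * trace (p + d) ∣ Y ∣ᵖ k
      ≡⟨ cong₂ (λ s t → trace p s k * trace (p + d) t k) X≡ Y≡ ⟩
    trace p (2 + p) k * trace (p + d) (2 + (p + d)) k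
      ≤⟨ trace-inequality p d k ⟩
    trace (p + d) (2 + p) k * trace (p + d) (2 + p) k
      ≡⟨ cong (λ s → trace (p + d) s k * trace (p + d) s k) X≡ ⟨
    trace (p + d) ∣ X ∣ᵖ k * trace (p + d) ∣ X ∣ᵖ k
      ≤⟨ *-mono-≤ (closed-lower k X Y Y≡) (closed-lower k X Y Y≡) ⟩
    closed n X Y * closed n X Y ∎
    where
    open ≤-Reasoning
    n = suc (k * 2)
    -- Both sizes are at least 2 here, and `p` and `p + d` are the constants e of the two-step
    -- matrices through `X` and through `Y`.
    p = ∣ X ∣ᵖ ∸ 2
    d = ∣ Y ∣ᵖ ∸ ∣ X ∣ᵖ
    X≡ : ∣ X ∣ᵖ ≡ 2 + p
    X≡ = sym (m+[n∸m]≡n (≰⇒> X≰1))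
    Y≡ : ∣ Y ∣ᵖ ≡ 2 + (p + d)
    Y≡ = sym (trans (cong (_+ d) (sym X≡)) (m+[n∸m]≡n X≤Y))

  -- `closed-≤` starts its mixed walks in the smaller palette; `closed-rotate` turns the square
  -- there into the product of the two mixed counts.
  closed-inequality : ∀ k X Y →
    closed (suc (k * 2)) X X * closed (suc (k * 2)) Y Y ≤ closed (suc (k * 2)) X Y * closed (suc (k * 2)) Y X
  closed-inequality k X Y with ≤-total ∣ X ∣ᵖ ∣ Y ∣ᵖ
  ... | inj₁ X≤Y = ≤-trans (closed-≤ k X Y X≤Y)
    (≤-reflexive (cong (closed (suc (k * 2)) X Y *_) (closed-rotate k X Y)))
  ... | inj₂ Y≤X = ≤-trans (≤-reflexive (*-comm (closed (suc (k * 2)) X X) _)) (≤-trans (closed-≤ k Y X Y≤X)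
    (≤-reflexive (cong (_* closed (suc (k * 2)) Y X) (closed-rotate k Y X))))

  -- Colourings of a cycle as closed walks.

  Listed : ∀ {n} → (Fin n → Palette q) → (Fin n → Colour) → Set
  Listed L f = ∀ i → T (L i (f i))

  listed? : ∀ {n} (L : Fin n → Palette q) f → Dec (Listed L f)
  listed? L f = all? λ i → T? (L i (f i))

  fitsᴸ : ∀ {n} → (Fin n → Palette q) → (Fin n → Colour) → ℕ
  fitsᴸ L f = ⟦ listed? L f ⟧

  fitsᴸ-∷ : ∀ {n} (L : Fin (suc n) → Palette q) c f → fitsᴸ L (c ∷ f) ≡ 𝟙 (L zero c) * fitsᴸ (L ∘ suc) f
  fitsᴸ-∷ L c f = ⟦⟧-split (listed? L (c ∷ f)) (T? (L zero c)) (listed? (L ∘ suc) f)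
    (λ h → h zero , h ∘ suc) (λ { t h zero → t ; t h (suc i) → h i })

  fitsᴸ-ext : ∀ {n} (L : Fin n → Palette q) → Extensional (fitsᴸ L)
  fitsᴸ-ext L {f} {g} p = ⟦⟧-cong (listed? L f) (listed? L g)
    (λ h i → subst (T ∘ L i) (p i) (h i)) (λ h i → subst (T ∘ L i) (sym (p i)) (h i))

  link : ∀ n → (Fin (suc n) → Colour) → Colour → ℕ
  link zero    h v = differ (h zero) v
  link (suc n) h v = differ (h zero) (h (suc zero)) * link n (h ∘ suc) v

  link-ext : ∀ n {h h′ : Fin (suc n) → Colour} v → h ≗ h′ → link n h v ≡ link n h′ v
  link-ext zero    v p = cong (λ c → differ c v) (p zero)
  link-ext (suc n) v p = cong₂ _*_ (cong₂ differ (p zero) (p (suc zero))) (link-ext n v (p ∘ suc))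

  -- A relational form of `link`, phrased through `Next` and the last index so that it can be
  -- matched with the edges of `cycle`.
  Linked : ∀ {n} → (Fin (suc n) → Colour) → Colour → Set
  Linked {n} h v = (∀ i j → Next i j → h i ≢ h j) × (∀ i → suc (toℕ i) ≡ suc n → h i ≢ v)

  linked? : ∀ {n} (h : Fin (suc n) → Colour) v → Dec (Linked h v)
  linked? {n} h v = (all? λ i → all? λ j → next? i j →-dec ¬? (h i ≟ h j)) ×-dec
    (all? λ i → (suc (toℕ i) ℕ.≟ suc n) →-dec ¬? (h i ≟ v))

  linked-link : ∀ n (h : Fin (suc n) → Colour) v → ⟦ linked? h v ⟧ ≡ link n h v
  linked-link zero    h v = ⟦⟧-cong (linked? h v) (¬? (h zero ≟ v))
    (λ (_ , last) → last zero refl) (λ ne → (λ { zero zero () }) , λ { zero _ → ne })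
  linked-link (suc n) h v = trans
    (⟦⟧-split (linked? h v) (¬? (h zero ≟ h (suc zero))) (linked? (h ∘ suc) v)
      (λ (next , last) → next zero (suc zero) refl ,
        (λ i j e → next (suc i) (suc j) (cong suc e)) , (λ i e → last (suc i) (cong suc e)))
      (λ ne (next , last) → extend ne next , λ { zero () ; (suc i) e → last i (suc-injective e) }))
    (cong (differ (h zero) (h (suc zero)) *_) (linked-link n (h ∘ suc) v))
    where
    extend : h zero ≢ h (suc zero) → (∀ i j → Next i j → h (suc i) ≢ h (suc j)) → ∀ i j → Next i j → h i ≢ h j
    extend ne next zero    (suc zero)    e = ne
    extend ne next zero    (suc (suc j)) ()
    extend ne next (suc i) (suc j)       e = next i j (suc-injective e)

  sum-link : ∀ n X Y u v → ∑ⁿ n (λ f → fitsᴸ (alternate X Y) f * link n (u ∷ f) v) ≡ walk n X Y u v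
  sum-link-ext : ∀ n X Y u v → Extensional (λ f → fitsᴸ (alternate X Y) f * link n (u ∷ f) v)
  sum-link-ext n X Y u v p = cong₂ _*_ (fitsᴸ-ext (alternate X Y) p)
    (link-ext n v λ { zero → refl ; (suc i) → p i })
  sum-link zero    X Y u v = trans (∑-[] _ (sum-link-ext 0 X Y u v) none)
    (trans (cong (_* differ u v) (⟦⟧-yes (listed? (alternate X Y) none) λ ())) (*-identityˡ (differ u v)))
    where
    none : Fin 0 → Colour
    none ()
  sum-link (suc n) X Y u v = trans (∑-∷ n (sum-link-ext (suc n) X Y u v)) (sum-cong-≗ λ c → begin
    ∑ⁿ n (λ f → fitsᴸ (alternate X Y) (c ∷ f) * (differ u c * link n (c ∷ f) v))
      ≡⟨ ∑-cong F (λ f → trans (cong (_* (differ u c * link n (c ∷ f) v)) (fitsᴸ-∷ (alternate X Y) c f))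
           (regroup (𝟙 (X c)) (fitsᴸ (alternate Y X) f) (differ u c) (link n (c ∷ f) v))) ⟩
    ∑ⁿ n (λ f → 𝟙 (X c) * differ u c * (fitsᴸ (alternate Y X) f * link n (c ∷ f) v))
      ≡⟨ ∑-*ˡ F (𝟙 (X c) * differ u c) _ ⟨
    𝟙 (X c) * differ u c * ∑ⁿ n (λ f → fitsᴸ (alternate Y X) f * link n (c ∷ f) v)
      ≡⟨ cong (𝟙 (X c) * differ u c *_) (sum-link n Y X c v) ⟩
    𝟙 (X c) * differ u c * walk n Y X c v
      ≡⟨ *-assoc (𝟙 (X c)) (differ u c) (walk n Y X c v) ⟩
    𝟙 (X c) * (differ u c * walk n Y X c v) ∎)
    where
    open ≡-Reasoning
    F = finite-colouring {q} (↔-id (Fin n))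
    regroup : ∀ a b c d → a * b * (c * d) ≡ a * c * (b * d)
    regroup = solve-∀

  module _ (k : ℕ) (3≤n : 3 ≤ suc k * 2) where
    private
      m : ℕ
      m = suc (k * 2)
      C = cycle (suc m) 3≤n
      F = finite-colouring {q} (index C)

    -- Cuts the cycle open at vertex `zero`: the wrapping edge becomes the constraint of the last
    -- vertex against `f zero`.
    proper-link : ∀ f → proper C f ≡ link m f (f zero)
    proper-link f = trans
      (⟦⟧-cong (cross? C f f) (linked? f (f zero))
        (λ c → (λ i j e → c i j (inj₁ (inj₁ e))) , (λ i e → c i zero (inj₁ (inj₂ (e , refl)))))
        (λ (next , last) i j → [ forward next last i j , (λ e → forward next last j i e ∘ sym) ]))
      (linked-link m f (f zero))
      where
      forward : (∀ i j → Next i j → f i ≢ f j) → (∀ i → suc (toℕ i) ≡ suc m → f i ≢ f zero) →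
        ∀ i j → CyclicNext i j → f i ≢ f j
      forward next last i j       (inj₁ e)        = next i j e
      forward next last i zero    (inj₂ (e , _))  = last i e
      forward next last i (suc j) (inj₂ (e , ()))

    sum-closed : ∀ X Y → ∑ᴳ C (λ f → fitsᴸ (alternate X Y) f * proper C f) ≡ closed m X Y
    sum-closed X Y = trans
      (∑-∷ m (λ p → cong₂ _*_ (fitsᴸ-ext (alternate X Y) p) (cross-ext C p p)))
      (sum-cong-≗ λ c → trans
        (∑-cong F′ λ f → trans
          (cong₂ _*_ (fitsᴸ-∷ (alternate X Y) c f) (proper-link (c ∷ f)))
          (*-assoc (𝟙 (X c)) (fitsᴸ (alternate Y X) f) (link m (c ∷ f) c)))
        (trans (sym (∑-*ˡ F′ (𝟙 (X c)) _)) (cong (𝟙 (X c) *_) (sum-link m Y X c c))))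
      where F′ = finite-colouring {q} (↔-id (Fin m))

    cycle-χ : ∀ X → χ C X ≡ closed m X X
    cycle-χ X = trans
      (∑-cong F λ f → cong (_* proper C f) (⟦⟧-cong (within? (index C) X f) (listed? (alternate X X) f)
        (λ h i → subst (λ Z → T (Z (f i))) (sym (alternate-const X i)) (h i))
        (λ h i → subst (λ Z → T (Z (f i))) (alternate-const X i) (h i))))
      (sum-closed X X)

    private
      side : Fin (suc m) → Bool
      side = alternate true false

    side-cyclicNext : ∀ i j → CyclicNext i j → side j ≡ not (side i)
    side-cyclicNext i j       (inj₁ e)        =
      trans (alternate-next i j e) (sym (alternate-map not true false i))
    side-cyclicNext i zero    (inj₂ (e , _))  = cong not (sym (alternate-last (suc k) i e))
    side-cyclicNext i (suc j) (inj₂ (e , ()))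

    -- After the exchange at the odd positions, `f` takes over the constraint of the other palette
    -- there, so each of the two maps has an alternating list.
    select-listed : ∀ X Y (f g : Fin (suc m) → Colour) →
      fits C X (select side f g) * fits C Y (select side g f) ≡ fitsᴸ (alternate X Y) f * fitsᴸ (alternate Y X) g
    select-listed X Y f g = trans (sym (⟦⟧-× X? Y?)) (⟦⟧-split (X? ×-dec Y?)
      (listed? (alternate X Y) f) (listed? (alternate Y X) g)
      (λ (h , h′) → (λ i → proj₁ (to i (h i) (h′ i))) , (λ i → proj₂ (to i (h i) (h′ i))))
      (λ h h′ → (λ i → proj₁ (from i (h i) (h′ i))) , (λ i → proj₂ (from i (h i) (h′ i)))))
      where
      X? = within? (index C) X (select side f g)
      Y? = within? (index C) Y (select side g f)
      alternate-side : ∀ X Y (i : Fin (suc m)) → (if side i then X else Y) ≡ alternate X Y i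
      alternate-side X Y i = alternate-map (if_then X else Y) true false i
      distribute : ∀ b {c d} → T (X (if b then c else d)) × T (Y (if b then d else c)) →
        T ((if b then X else Y) c) × T ((if b then Y else X) d)
      distribute true  (h , h′) = h , h′
      distribute false (h , h′) = h′ , h
      collect : ∀ b {c d} → T ((if b then X else Y) c) × T ((if b then Y else X) d) →
        T (X (if b then c else d)) × T (Y (if b then d else c))
      collect true  (h , h′) = h , h′
      collect false (h , h′) = h′ , h
      to : ∀ i → T (X (select side f g i)) → T (Y (select side g f i)) →
        T (alternate X Y i (f i)) × T (alternate Y X i (g i))
      to i h h′ = subst₂ (λ Z Z′ → T (Z (f i)) × T (Z′ (g i))) (alternate-side X Y i) (alternate-side Y X i)
        (distribute (side i) (h , h′))
      from : ∀ i → T (alternate X Y i (f i)) → T (alternate Y X i (g i)) →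
        T (X (select side f g i)) × T (Y (select side g f i))
      from i h h′ = collect (side i) (subst₂ (λ Z Z′ → T (Z (f i)) × T (Z′ (g i)))
        (sym (alternate-side X Y i)) (sym (alternate-side Y X i)) (h , h′))

    -- Neighbours on the cycle have opposite sides, so each crossed condition on the exchanged pair
    -- concerns only `f` or only `g`.
    select-cross : ∀ (f g : Fin (suc m) → Colour) →
      cross C (select side f g) (select side g f) ≡ proper C f * proper C g
    select-cross f g = ⟦⟧-split (cross? C (select side f g) (select side g f)) (cross? C f f) (cross? C g g)
      (λ c → (λ i j e → proj₁ (select-≢ (side-~ i j e) (c i j e) (c j i (Graph.~-sym C e)))) ,
             (λ i j e → proj₂ (select-≢ (side-~ i j e) (c i j e) (c j i (Graph.~-sym C e)))))
      (λ c d i j e → ≢-select (side-~ i j e) (c i j e) (d i j e))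
      where
      side-~ : ∀ i j → CyclicNext i j ⊎ CyclicNext j i → side j ≡ not (side i)
      side-~ i j (inj₁ e) = side-cyclicNext i j e
      side-~ i j (inj₂ e) = trans (sym (not-involutive (side j))) (cong not (sym (side-cyclicNext j i e)))
      select-≢ : ∀ {a b} → b ≡ not a → ∀ {c d c′ d′ : Colour} →
        (if a then c else d) ≢ (if b then d′ else c′) → (if b then c′ else d′) ≢ (if a then d else c) →
        c ≢ c′ × d ≢ d′
      select-≢ {true}  refl n n′ = n , n′ ∘ sym
      select-≢ {false} refl n n′ = n′ ∘ sym , n
      ≢-select : ∀ {a b} → b ≡ not a → ∀ {c d c′ d′ : Colour} →
        c ≢ c′ → d ≢ d′ → (if a then c else d) ≢ (if b then d′ else c′)
      ≢-select {true}  refl n n′ = n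
      ≢-select {false} refl n n′ = n′

    -- The exchange decouples the pair: `f` and `g` become independent proper colourings of the
    -- cycle whose alternating palettes start with `X` and `Y` respectively.
    cycle-χ₂ : ∀ X Y → χ₂ C X Y ≡ closed m X Y * closed m Y X
    cycle-χ₂ X Y = begin
      χ₂ C X Y
        ≡⟨ ∑-exchange (index C) side (χ₂-ext C X Y) ⟩
      ∑ᴳ C (λ f → ∑ᴳ C (λ g → (fits C X (select side f g) * fits C Y (select side g f)) *
        cross C (select side f g) (select side g f)))
        ≡⟨ ∑-cong F (λ f → ∑-cong F λ g → trans
             (cong₂ _*_ (select-listed X Y f g) (select-cross f g))
             (regroup (fitsᴸ (alternate X Y) f) (fitsᴸ (alternate Y X) g) (proper C f) (proper C g))) ⟩
      ∑ᴳ C (λ f → ∑ᴳ C (λ g → (fitsᴸ (alternate X Y) f * proper C f) * (fitsᴸ (alternate Y X) g * proper C g)))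
        ≡⟨ ∑-product F F _ _ ⟨
      ∑ᴳ C (λ f → fitsᴸ (alternate X Y) f * proper C f) * ∑ᴳ C (λ g → fitsᴸ (alternate Y X) g * proper C g)
        ≡⟨ cong₂ _*_ (sum-closed X Y) (sum-closed Y X) ⟩
      closed m X Y * closed m Y X ∎
      where
      open ≡-Reasoning
      regroup : ∀ a b c d → (a * b) * (c * d) ≡ (a * c) * (b * d)
      regroup = solve-∀

    Good-cycle : Good q C
    Good-cycle X Y = subst₂ _≤_ (sym (cong₂ _*_ (cycle-χ X) (cycle-χ Y))) (sym (cycle-χ₂ X Y)) (closed-inequality k X Y)

  Good-evenCycle : ∀ G → EvenCycle G → Good q G
  Good-evenCycle G (_ , () , divides zero refl , iso)
  Good-evenCycle G (_ , 3≤n , divides (suc k) refl , iso) = Good-≅ iso (Good-cycle k 3≤n)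

-- Assembly over the three kinds of graphs in `𝓗`.

theorem1p4 : (F H : Graph) → Bipartite F → IsBlowUp 𝓗 F H → (q : ℕ) → 2 ≤ q → hom H (K q) ^ 2 ≤ hom (H ×ᵍ K 2) (K q)
theorem1p4 F H bipartite H-blowUp q _ = blowUp-inequality F H bipartite q 𝓗 𝓗⇒Good H-blowUp
  where
  𝓗⇒Good : ∀ G → 𝓗 G → Good q G
  𝓗⇒Good G (inj₁ multi)               = Good-completeMultipartite G multi
  𝓗⇒Good G (inj₂ (inj₁ even))         = Good-evenCycle G even
  𝓗⇒Good G (inj₂ (inj₂ (n , _ , iso))) = Good-≅ iso (Good-path n)
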